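{- Let $q=2^f>8$. There is no nontrivial $2$-$(v,k,2)$ design $\mathcal{D}$ with $(v,b,r,k)=\left(\frac{q(q-1)}{2},\,2(q^2-1),\,2(q+1),\,\frac{q}{2}\right)$ admitting a flag-transitive automorphism group $G$ with $\mathrm{Soc}(G)=T\cong PSL(2,q)$ such that $T_x\cong D_{2(q+1)}$ for a point $x$ and $T_B\cong Z_2^{f-1}$ or $T_B\cong Z_2^{f}$ for a block $B$.
   Context: A $2$-$(v,k,2)$ design: $v$ points, blocks of size $k$, every two distinct points in exactly $2$ blocks; $b$ is the number of blocks and $r$ the number of blocks through a point; nontrivial means $2<k<v-1$. Flag-transitive means transitive on incident point-block pairs. $D_n$ is the dihedral group of order $n$; $T_x,T_B$ are stabilizers in $T$. -}

module Defs where

open import Level using (0ℓ)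
open import Data.Nat using (ℕ; suc; _∸_)
import Data.Nat as ℕ
open import Data.Nat.DivMod using (_mod_)
open import Data.Bool using (Bool; true; false; _∧_; _xor_; if_then_else_)
open import Data.Fin using (Fin; toℕ)
open import Data.Fin.Subset using (Subset; _∈_; ∣_∣)
open import Data.Fin.Permutation using (Permutation′; _⟨$⟩ʳ_; _⟨$⟩ˡ_; _∘ₚ_; id; flip; _≈_)
open import Data.Vec using (Vec; lookup; tabulate; zipWith)
open import Data.Product using (Σ; ∃; _×_; _,_; proj₁)
open import Data.Sum using (_⊎_)
open import Relation.Binary.PropositionalEquality using (_≡_; _≢_)
open import Relation.Nullary using (¬_)
open import Relation.Unary using (Pred)
import Algebra.Structures as AS

Perm : ℕ → Set
Perm = Permutation′

-- group product, (g · h) x = g (h x)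
_·_ : ∀ {n} → Perm n → Perm n → Perm n
g · h = h ∘ₚ g

_[_] : ∀ {n} → Perm n → Subset n → Subset n
g [ S ] = tabulate (λ y → lookup S (g ⟨$⟩ˡ y))

record Design (v b k : ℕ) : Set where
  field
    block           : Fin b → Subset v
    block-injective : ∀ i j → block i ≡ block j → i ≡ j
    block-size      : ∀ i → ∣ block i ∣ ≡ k
    pair-count      : ∀ (x y : Fin v) → x ≢ y →
                      ∣ tabulate (λ i → lookup (block i) x ∧ lookup (block i) y) ∣ ≡ 2

  replication : Fin v → ℕ
  replication x = ∣ tabulate (λ i → lookup (block i) x) ∣

open Design public

PermSet : ℕ → Set₁
PermSet v = Pred (Perm v) 0ℓ

_⊑_ : ∀ {v} → PermSet v → PermSet v → Set
H ⊑ K = ∀ g → H g → K g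

record IsSubgroup {v : ℕ} (H : PermSet v) : Set where
  field
    resp   : ∀ g h → g ≈ h → H g → H h
    has-id : H id
    mul    : ∀ g h → H g → H h → H (g · h)
    inv    : ∀ g → H g → H (flip g)

Trivial : ∀ {v} → PermSet v → Set
Trivial N = ∀ g → N g → g ≈ id

IsNormal : ∀ {v} → PermSet v → PermSet v → Set
IsNormal G N = IsSubgroup N × N ⊑ G × (∀ g n → G g → N n → N ((g · n) · flip g))

IsMinimalNormal : ∀ {v} → PermSet v → PermSet v → Set₁
IsMinimalNormal G N = IsNormal G N × ¬ Trivial N ×
  (∀ M → IsNormal G M → M ⊑ N → Trivial M ⊎ N ⊑ M)

IsSocle : ∀ {v} → PermSet v → PermSet v → Set₁
IsSocle G T = IsSubgroup T × (∀ N → IsMinimalNormal G N → N ⊑ T) ×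
  (∀ H → IsSubgroup H → (∀ N → IsMinimalNormal G N → N ⊑ H) → T ⊑ H)

PointStab : ∀ {v} → PermSet v → Fin v → PermSet v
PointStab T x g = T g × g ⟨$⟩ʳ x ≡ x

SetStab : ∀ {v} → PermSet v → Subset v → PermSet v
SetStab T B g = T g × g [ B ] ≡ B

IsAutomorphism : ∀ {v b k} → Design v b k → Perm v → Set
IsAutomorphism D g = ∀ i → ∃ λ j → g [ block D i ] ≡ block D j

IsAutGroup : ∀ {v b k} → Design v b k → PermSet v → Set
IsAutGroup D G = IsSubgroup G × (∀ g → G g → IsAutomorphism D g)

FlagTransitive : ∀ {v b k} → Design v b k → PermSet v → Set
FlagTransitive D G = ∀ x i y j → x ∈ block D i → y ∈ block D j →
  ∃ λ g → G g × g ⟨$⟩ʳ x ≡ y × g [ block D i ] ≡ block D j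

IsoTo : ∀ {v} → PermSet v → (C : Set) → (C → C → C) → Set
IsoTo {v} H C _∙_ = Σ (C → Perm v) λ φ →
  (∀ c → H (φ c)) ×
  (∀ c d → φ (c ∙ d) ≈ φ c · φ d) ×
  (∀ c d → φ c ≈ φ d → c ≡ d) ×
  (∀ g → H g → ∃ λ c → φ c ≈ g)

-- dihedral group of order 2(m+1): Z_{m+1} ⋊ Z_2, elements (a, ε) = ρ^a σ^ε
DihedralMul : (m : ℕ) → (Fin (suc m) × Bool) → (Fin (suc m) × Bool) → (Fin (suc m) × Bool)
DihedralMul m (a , ε) (b , δ) =
  ((toℕ a ℕ.+ (if ε then (suc m ∸ toℕ b) else toℕ b)) mod suc m) , (ε xor δ)

ElemAbMul : (n : ℕ) → Vec Bool n → Vec Bool n → Vec Bool n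
ElemAbMul n = zipWith _xor_

record FieldOn (q : ℕ) : Set where
  field
    _+_ _*_ : Fin q → Fin q → Fin q
    -_      : Fin q → Fin q
    0# 1#   : Fin q
    isCommutativeRing : AS.IsCommutativeRing _≡_ _+_ _*_ -_ 0# 1#
    0≢1     : 0# ≢ 1#
    inverse : ∀ x → x ≢ 0# → ∃ λ y → x * y ≡ 1#

module _ {q : ℕ} (F : FieldOn q) where
  open FieldOn F

  record Mat2 : Set where
    constructor mat
    field a b c d : Fin q

  det : Mat2 → Fin q
  det (mat a b c d) = (a * d) + (- (b * c))

  matMul : Mat2 → Mat2 → Mat2
  matMul (mat a b c d) (mat a' b' c' d') =
    mat ((a * a') + (b * c')) ((a * b') + (b * d'))
        ((c * a') + (d * c')) ((c * b') + (d * d'))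

  SL2 : Set
  SL2 = Σ Mat2 λ A → det A ≡ 1#

  IsScalar : Mat2 → Set
  IsScalar (mat a b c d) = b ≡ 0# × c ≡ 0# × a ≡ d

  -- H ≅ PSL(2,F) = SL(2,F)/Z, Z the scalar matrices: a surjective
  -- homomorphism SL(2,F) → H whose kernel is exactly Z
  IsoPSL2Over : ∀ {v} → PermSet v → Set
  IsoPSL2Over {v} H = Σ (SL2 → Perm v) λ φ →
    (∀ A → H (φ A)) ×
    (∀ A B C → proj₁ C ≡ matMul (proj₁ A) (proj₁ B) → φ C ≈ φ A · φ B) ×
    (∀ A → φ A ≈ id → IsScalar (proj₁ A)) ×
    (∀ A → IsScalar (proj₁ A) → φ A ≈ id) ×
    (∀ g → H g → ∃ λ A → φ A ≈ g)

IsoPSL2 : ∀ {v} → ℕ → PermSet v → Set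
IsoPSL2 q H = Σ (FieldOn q) λ F → IsoPSL2Over F H

{-# OPTIONS --safe #-}
module Submission where

-- T = SL(2,q) in characteristic 2.  Every point stabilizer is dihedral of order 2(q + 1), and its
-- q + 1 reflections exhaust, up to scalars, the matrices M with tr M = tr (M A) = 0, where A is one
-- of its rotations.  Two such planes meet, so any two points x, y are fixed by a common involution τ;
-- likewise the centralizer of any involution contains exactly one involution fixing a given point.
-- Counting over a Borel subgroup shows T is transitive, so the centralizer of τ contains some h
-- interchanging x and y.
-- Let x, y lie in the block B.  As λ = 2, two of B, τ B, h B coincide, so τ, h or τ h lies in T_B.
-- Since T_B is elementary abelian, the involutions of a Sylow subgroup above T_B fixing x and y
-- then agree.  Hence a single involution fixes B pointwise, and by flag-transitivity the same holds
-- for every block.  An involution fixes only q/2 = k points, so distinct blocks belong to distinct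
-- involutions; but there are fewer than 2(q² - 1) of these.

open import Defs
open import Level using (0ℓ)
open import Algebra.Bundles using (CommutativeRing; RawRing)
import Algebra.Solver.Ring
import Algebra.Solver.Ring.AlmostCommutativeRing as ACR
open import Data.Bool as Bool using (Bool; true; false; _∧_)
open import Data.Bool.Properties using (xor-∧-commutativeRing; xor-comm; xor-same)
open import Data.Empty using (⊥)
open import Data.Fin using (Fin; zero; suc; punchIn; punchOut; toℕ; combine; remQuot)
open import Data.Fin.Permutation as Perm using (_⟨$⟩ʳ_; _⟨$⟩ˡ_; id; flip; _≈_; inverseˡ; inverseʳ)
open import Data.Fin.Properties as Fin using (_≟_; any?)
open import Data.Fin.Subset using (Subset; _∈_; _⊆_; ∣_∣; _-_)
import Data.Fin.Subset.Properties as Subset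
open import Data.Maybe using (just; nothing)
open import Data.Nat as ℕ using (ℕ; zero; suc)
open import Data.Nat.DivMod
open import Data.Nat.Divisibility
import Data.Nat.Properties as ℕ
open import Data.Nat.Solver using (module +-*-Solver)
open import Data.Product using (Σ; ∃; ∃₂; _×_; _,_; proj₁; proj₂)
open import Data.Sum using (_⊎_; inj₁; inj₂)
open import Data.Vec using (Vec; []; _∷_; here; there; lookup; tabulate; replicate)
open import Data.Vec.Properties using (lookup∘tabulate; tabulate∘lookup; tabulate-cong; lookup⇒[]=; []=⇒lookup; zipWith-comm)
open import Function.Definitions using (Injective)
open import Relation.Binary.Definitions using (WeaklyDecidable)
open import Relation.Binary.PropositionalEquality hiding ([_]; resp)
open import Relation.Nullary using (¬_; Dec; yes; no; contradiction; does)
open import Relation.Nullary.Decidable using (dec-true)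
open +-*-Solver using () renaming (solve to ℕsolve; _:=_ to _ℕ:=_; _:+_ to _ℕ:+_; _:*_ to _ℕ:*_; con to ℕcon)

-- In characteristic 2 the centre of SL(2,q) is trivial, so PSL(2,q) is SL(2,q) itself, and an
-- element other than I is an involution exactly when its trace is 0. Up to scalars, the matrices of
-- trace 0 form a projective plane, and the involutions are points of it. The reflections fixing a
-- point x are q + 1 distinct points of one line, hence all of it: this is where the order 2(q + 1)
-- enters. Every point of that line is therefore an involution, so the line misses I and all
-- matrices of determinant 0. The centralizer of an involution u is the set of I + t(u + I), a copy
-- of the additive group of the field. In the plane it is a line through I and the nilpotent u + I,
-- with the latter removed; it meets the line of x in exactly one point, and this is the unique
-- involution of the centralizer fixing x. The group T_B may be a full Sylow 2-subgroup or have
-- index 2 in one. Both cases are handled at once by choosing a single nontrivial element of T_B: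
-- its centralizer is a Sylow subgroup that contains T_B.

injective⇒surjective : ∀ {m n} → m ≡ n → (f : Fin m → Fin n) → Injective _≡_ _≡_ f → ∀ y → ∃ λ x → f x ≡ y
injective⇒surjective {n = suc n} refl f f-inj y with any? (λ x → f x ≟ y)
... | yes hit = hit
... | no miss = contradiction (Fin.injective⇒≤ g-inj) ℕ.1+n≰n
  where
  y≢f : ∀ x → y ≢ f x
  y≢f x y≡fx = miss (x , sym y≡fx)
  g-inj : Injective _≡_ _≡_ (λ x → punchOut (y≢f x))
  g-inj {x} {x'} eq = f-inj (Fin.punchOut-injective (y≢f x) (y≢f x') eq)

enumerate : ∀ {n} (S : Subset n) →
  Σ (Fin ∣ S ∣ → Fin n) λ e → (∀ j → e j ∈ S) × Injective _≡_ _≡_ e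
enumerate []          = (λ ()) , (λ ()) , λ { {()} }
enumerate (false ∷ S) with enumerate S
... | e , e∈ , inj = (λ j → suc (e j)) , (λ j → there (e∈ j)) , λ eq → inj (Fin.suc-injective eq)
enumerate {suc n} (true ∷ S)  with enumerate S
... | e , e∈ , inj = e′ , e′∈ , e′-inj
  where
  e′ : Fin (suc ∣ S ∣) → Fin (suc n)
  e′ zero    = zero
  e′ (suc j) = suc (e j)
  e′∈ : ∀ j → e′ j ∈ (true ∷ S)
  e′∈ zero    = here
  e′∈ (suc j) = there (e∈ j)
  e′-inj : Injective _≡_ _≡_ e′
  e′-inj {zero}  {zero}  _  = refl
  e′-inj {suc _} {suc _} eq = cong suc (inj (Fin.suc-injective eq))

distinct-triple : ∀ {n} {S : Subset n} {i j l} → i ∈ S → j ∈ S → l ∈ S →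
  i ≢ j → i ≢ l → j ≢ l → 2 ℕ.< ∣ S ∣
distinct-triple {S = S} {i} {j} {l} i∈ j∈ l∈ i≢j i≢l j≢l =
  ℕ.≤-trans (ℕ.s≤s (ℕ.≤-trans (ℕ.s≤s (ℕ.≤-trans (ℕ.s≤s ℕ.z≤n)
    (Subset.x∈p⇒∣p-x∣<∣p∣ l∈′))) (Subset.x∈p⇒∣p-x∣<∣p∣ j∈′))) (Subset.x∈p⇒∣p-x∣<∣p∣ i∈)
  where
  j∈′ : j ∈ S - i
  j∈′ = Subset.x∈p∧x≢y⇒x∈p-y j∈ (≢-sym i≢j)
  l∈′ : l ∈ (S - i) - j
  l∈′ = Subset.x∈p∧x≢y⇒x∈p-y (Subset.x∈p∧x≢y⇒x∈p-y l∈ (≢-sym i≢l)) (≢-sym j≢l)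

⊆∧∣∣≥⇒≡ : ∀ {n} {p q : Subset n} → p ⊆ q → ∣ q ∣ ℕ.≤ ∣ p ∣ → p ≡ q
⊆∧∣∣≥⇒≡ {p = p} {q} p⊆q ∣q∣≤∣p∣ = Subset.⊆-antisym p⊆q q⊆p
  where
  q⊆p : q ⊆ p
  q⊆p {x} x∈q with x Subset.∈? p
  ... | yes x∈p = x∈p
  ... | no  x∉p = contradiction ∣q∣≤∣p∣ (ℕ.<⇒≱ (Subset.p⊂q⇒∣p∣<∣q∣ (p⊆q , x , x∈q , x∉p)))

∣∣>0⇒nonempty : ∀ {n} (p : Subset n) → 0 ℕ.< ∣ p ∣ → ∃ λ x → x ∈ p
∣∣>0⇒nonempty {n} p 0<∣p∣ with Subset.nonempty? p
... | yes nonempty = nonempty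
... | no  empty    = contradiction
  (subst (0 ℕ.<_) (trans (cong ∣_∣ (Subset.Empty-unique empty)) (Subset.∣⊥∣≡0 n)) 0<∣p∣) λ ()

-- The characteristic of a field with `2 ^ f` elements.

module FieldProperties {q : ℕ} (F : FieldOn q) where
  open FieldOn F public

  ring : CommutativeRing 0ℓ 0ℓ
  ring = record { isCommutativeRing = isCommutativeRing }

  open CommutativeRing ring public
    using (+-assoc; +-comm; +-identityˡ; +-identityʳ; -‿inverseˡ; -‿inverseʳ;
           *-assoc; *-comm; *-identityˡ; *-identityʳ; distribˡ; distribʳ; zeroˡ; zeroʳ)
  open import Algebra.Properties.Ring (CommutativeRing.ring ring) public
    using (+-cancelˡ; +-cancelʳ)
  open import Algebra.Properties.CommutativeMonoid.Sum (CommutativeRing.+-commutativeMonoid ring)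
  open import Algebra.Properties.Semiring.Mult (CommutativeRing.semiring ring)
    using (×1-homo-*) renaming (_×_ to _×ℕ_)

  *-zero⇒zero : ∀ x y → x ≢ 0# → x * y ≡ 0# → y ≡ 0#
  *-zero⇒zero x y x≢0 xy≡0 with inverse x x≢0
  ... | x⁻¹ , xx⁻¹≡1 = begin
    y               ≡⟨ *-identityˡ y ⟨
    1# * y          ≡⟨ cong (_* y) (trans (*-comm x⁻¹ x) xx⁻¹≡1) ⟨
    (x⁻¹ * x) * y   ≡⟨ *-assoc x⁻¹ x y ⟩
    x⁻¹ * (x * y)   ≡⟨ cong (x⁻¹ *_) xy≡0 ⟩
    x⁻¹ * 0#        ≡⟨ zeroʳ x⁻¹ ⟩
    0#              ∎
    where open ≡-Reasoning

  -- Translation by 1 permutes the field, so it does not change the sum of all elements.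
  order×1≡0 : q ×ℕ 1# ≡ 0#
  order×1≡0 = +-cancelˡ (sum id′) (q ×ℕ 1#) 0# (begin
    sum id′ + (q ×ℕ 1#)             ≡⟨ cong (sum id′ +_) (sum-replicate q) ⟨
    sum id′ + sum {q} (λ _ → 1#)   ≡⟨ ∑-distrib-+ id′ (λ _ → 1#) ⟨
    sum (λ x → x + 1#)             ≡⟨ sum-permute id′ shift ⟨
    sum id′                        ≡⟨ +-identityʳ _ ⟨
    sum id′ + 0#                   ∎)
    where
    open ≡-Reasoning
    id′ : Fin q → Fin q
    id′ x = x
    shift : Perm.Permutation′ q
    shift = Perm.permutation (_+ 1#) (_+ (- 1#))
      (λ x → trans (+-assoc x _ _) (trans (cong (x +_) (-‿inverseˡ 1#)) (+-identityʳ x)))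
      (λ x → trans (+-assoc x _ _) (trans (cong (x +_) (-‿inverseʳ 1#)) (+-identityʳ x)))

  -- A field has no zero divisors: as long as 2·1 is nonzero, one factor 2 can be cancelled.
  2^×1≡0⇒1+1≡0 : ∀ f → (2 ℕ.^ f) ×ℕ 1# ≡ 0# → 1# + 1# ≡ 0#
  2^×1≡0⇒1+1≡0 zero    eq = contradiction (sym (trans (sym (+-identityʳ 1#)) eq)) 0≢1
  2^×1≡0⇒1+1≡0 (suc f) eq with (1# + 1#) ≟ 0#
  ... | yes 1+1≡0 = 1+1≡0
  ... | no  1+1≢0 = 2^×1≡0⇒1+1≡0 f (*-zero⇒zero (2 ×ℕ 1#) _
          (λ 2≡0 → 1+1≢0 (trans (cong (1# +_) (sym (+-identityʳ 1#))) 2≡0))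
          (trans (sym (×1-homo-* 2 (2 ℕ.^ f))) eq))

  characteristic-2 : ∀ f → q ≡ 2 ℕ.^ f → 1# + 1# ≡ 0#
  characteristic-2 f q≡2^f = 2^×1≡0⇒1+1≡0 f (subst (λ n → n ×ℕ 1# ≡ 0#) q≡2^f order×1≡0)

-- Linear algebra of 2 × 2 matrices in characteristic 2.

module Characteristic2 {q : ℕ} (F : FieldOn q) (1+1≡0 : FieldOn._+_ F (FieldOn.1# F) (FieldOn.1# F) ≡ FieldOn.0# F) where
  open FieldProperties F public

  abstract
    x+x≡0 : ∀ x → x + x ≡ 0#
    x+x≡0 x = begin
      x + x                 ≡⟨ cong₂ _+_ (*-identityʳ x) (*-identityʳ x) ⟨
      (x * 1#) + (x * 1#)   ≡⟨ distribˡ x 1# 1# ⟨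
      x * (1# + 1#)         ≡⟨ cong (x *_) 1+1≡0 ⟩
      x * 0#                ≡⟨ zeroʳ x ⟩
      0#                    ∎
      where open ≡-Reasoning

    -x≡x : ∀ x → - x ≡ x
    -x≡x x = +-cancelˡ x (- x) x (trans (-‿inverseʳ x) (sym (x+x≡0 x)))

  private
    𝔽₂ : RawRing _ _
    𝔽₂ = CommutativeRing.rawRing xor-∧-commutativeRing

    F′ : ACR.AlmostCommutativeRing _ _
    F′ = ACR.fromCommutativeRing ring

    ⟦_⟧ : Bool → Fin q
    ⟦ false ⟧ = 0#
    ⟦ true  ⟧ = 1#

    prime-field : 𝔽₂ ACR.-Raw-AlmostCommutative⟶ F′
    prime-field = record
      { ⟦_⟧    = ⟦_⟧
      ; +-homo = λ { false y → sym (+-identityˡ ⟦ y ⟧)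
                   ; true false → sym (+-identityʳ 1#)
                   ; true true  → sym 1+1≡0 }
      ; *-homo = λ { false y → sym (zeroˡ ⟦ y ⟧)
                   ; true y  → sym (*-identityˡ ⟦ y ⟧) }
      ; -‿homo = λ x → sym (-x≡x ⟦ x ⟧)
      ; 0-homo = refl
      ; 1-homo = refl
      }

    coeff≟ : WeaklyDecidable (ACR.Induced-equivalence prime-field)
    coeff≟ x y with x Bool.≟ y
    ... | yes x≡y = just (cong ⟦_⟧ x≡y)
    ... | no  _   = nothing

  -- With coefficients in 𝔽₂ the solver works modulo 2.
  open Algebra.Solver.Ring 𝔽₂ F′ prime-field coeff≟ public
    using (solve; _:=_; _:+_; _:*_; :-_; con)

  abstract
    x+y≡0⇒x≡y : ∀ x y → x + y ≡ 0# → x ≡ y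
    x+y≡0⇒x≡y x y x+y≡0 = begin
      x             ≡⟨ solve 2 (λ x y → x := (x :+ y) :+ y) refl x y ⟩
      (x + y) + y   ≡⟨ cong (_+ y) x+y≡0 ⟩
      0# + y        ≡⟨ +-identityˡ y ⟩
      y             ∎
      where open ≡-Reasoning

    x*x≡0⇒x≡0 : ∀ x → x * x ≡ 0# → x ≡ 0#
    x*x≡0⇒x≡0 x xx≡0 with x ≟ 0#
    ... | yes x≡0 = x≡0
    ... | no  x≢0 = *-zero⇒zero x x x≢0 xx≡0

    -- Squaring is additive in characteristic 2, so its injectivity reduces to the absence of
    -- nilpotents.
    square-injective : ∀ x y → x * x ≡ y * y → x ≡ y
    square-injective x y xx≡yy = x+y≡0⇒x≡y x y (x*x≡0⇒x≡0 (x + y) (begin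
      (x + y) * (x + y)     ≡⟨ solve 2 (λ x y → (x :+ y) :* (x :+ y) := (x :* x) :+ (y :* y)) refl x y ⟩
      (x * x) + (y * y)     ≡⟨ cong (_+ (y * y)) xx≡yy ⟩
      (y * y) + (y * y)     ≡⟨ x+x≡0 (y * y) ⟩
      0#                    ∎))
      where open ≡-Reasoning

  Mat : Set
  Mat = Mat2 F

  infixl 7 _⊗_
  _⊗_ : Mat → Mat → Mat
  _⊗_ = matMul F

  Det : Mat → Fin q
  Det = det F

  mat-cong : ∀ {a a' b b' c c' d d'} → a ≡ a' → b ≡ b' → c ≡ c' → d ≡ d' →
    _≡_ {A = Mat} (mat a b c d) (mat a' b' c' d')
  mat-cong refl refl refl refl = refl

  I : Mat
  I = mat 1# 0# 0# 1#

  tr : Mat → Fin q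
  tr (mat a b c d) = a + d

  infixr 8 _•_
  _•_ : Fin q → Mat → Mat
  x • mat a b c d = mat (x * a) (x * b) (x * c) (x * d)

  -- In characteristic 2 the adjugate only swaps the diagonal entries.
  adj : Mat → Mat
  adj (mat a b c d) = mat d b c a

  SL : Set
  SL = SL2 F

  abstract
    det-⊗ : ∀ A B → Det (A ⊗ B) ≡ Det A * Det B
    det-⊗ (mat a b c d) (mat a' b' c' d') = solve 8 (λ a b c d a' b' c' d' →
      (((a :* a') :+ (b :* c')) :* ((c :* b') :+ (d :* d'))) :+ (:- (((a :* b') :+ (b :* d')) :* ((c :* a') :+ (d :* c'))))
      := ((a :* d) :+ (:- (b :* c))) :* ((a' :* d') :+ (:- (b' :* c')))) refl a b c d a' b' c' d'

    det-I : Det I ≡ 1#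
    det-I = solve 0 ((con true :* con true) :+ (:- (con false :* con false)) := con true) refl

    det-product : ∀ {A B} → Det A ≡ 1# → Det B ≡ 1# → Det (A ⊗ B) ≡ 1#
    det-product {A} {B} detA detB = trans (det-⊗ A B) (trans (cong₂ _*_ detA detB) (*-identityˡ 1#))

  infixl 7 _⊙_
  _⊙_ : SL → SL → SL
  (A , detA) ⊙ (B , detB) = A ⊗ B , det-product detA detB

  1ₛ : SL
  1ₛ = I , det-I

  abstract
    det-adj : ∀ A → Det (adj A) ≡ Det A
    det-adj (mat a b c d) = cong (_+ (- (b * c))) (*-comm d a)

  _⁻¹ₛ : SL → SL
  (A , detA) ⁻¹ₛ = adj A , trans (det-adj A) detA

  abstract
    adj-⊗ : ∀ A → adj A ⊗ A ≡ Det A • I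
    adj-⊗ (mat a b c d) = mat-cong
      (solve 4 (λ a b c d → (d :* a) :+ (b :* c) := ((a :* d) :+ (:- (b :* c))) :* con true) refl a b c d)
      (solve 4 (λ a b c d → (d :* b) :+ (b :* d) := ((a :* d) :+ (:- (b :* c))) :* con false) refl a b c d)
      (solve 4 (λ a b c d → (c :* a) :+ (a :* c) := ((a :* d) :+ (:- (b :* c))) :* con false) refl a b c d)
      (solve 4 (λ a b c d → (c :* b) :+ (a :* d) := ((a :* d) :+ (:- (b :* c))) :* con true) refl a b c d)

    1•A : ∀ A → 1# • A ≡ A
    1•A (mat a b c d) = mat-cong (*-identityˡ a) (*-identityˡ b) (*-identityˡ c) (*-identityˡ d)

    adj-inverse : ∀ A → Det A ≡ 1# → adj A ⊗ A ≡ I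
    adj-inverse A detA = trans (adj-⊗ A) (trans (cong (_• I) detA) (1•A I))

    -- Trace 0 makes the diagonal entries equal, so `A` is its own adjugate and hence its own
    -- inverse.
    tr≡0⇒involution : ∀ A → Det A ≡ 1# → tr A ≡ 0# → A ⊗ A ≡ I
    tr≡0⇒involution A@(mat a b c d) detA trA = trans (cong (_⊗ A) A≡adjA) (adj-inverse A detA)
      where
      a≡d : a ≡ d
      a≡d = x+y≡0⇒x≡y a d trA
      A≡adjA : A ≡ adj A
      A≡adjA = mat-cong a≡d refl refl (sym a≡d)

  -- (tr A)² = tr (A²) in characteristic 2.
  abstract
    involution⇒tr≡0 : ∀ A → A ⊗ A ≡ I → tr A ≡ 0#
    involution⇒tr≡0 (mat a b c d) AA≡I = x*x≡0⇒x≡0 (a + d) (begin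
      (a + d) * (a + d)   ≡⟨ solve 4 (λ a b c d → (a :+ d) :* (a :+ d) := ((a :* a) :+ (b :* c)) :+ ((c :* b) :+ (d :* d))) refl a b c d ⟩
      ((a * a) + (b * c)) + ((c * b) + (d * d))  ≡⟨ cong tr AA≡I ⟩
      1# + 1#             ≡⟨ 1+1≡0 ⟩
      0#                  ∎)
      where open ≡-Reasoning

    det-• : ∀ x A → Det (x • A) ≡ (x * x) * Det A
    det-• x (mat a b c d) = solve 5 (λ x a b c d →
      ((x :* a) :* (x :* d)) :+ (:- ((x :* b) :* (x :* c))) := (x :* x) :* ((a :* d) :+ (:- (b :* c)))) refl x a b c d

  -- I + t (u + I); for an involution u these matrices form the centralizer of u.
  pencil : Mat → Fin q → Mat
  pencil (mat a b c d) t = mat (1# + (t * (a + 1#))) (t * b) (t * c) (1# + (t * (d + 1#)))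

  abstract
    tr-pencil : ∀ u t → tr u ≡ 0# → tr (pencil u t) ≡ 0#
    tr-pencil (mat a b c d) t tru = begin
      (1# + (t * (a + 1#))) + (1# + (t * (d + 1#)))  ≡⟨ solve 3 (λ a d t → (con true :+ (t :* (a :+ con true))) :+ (con true :+ (t :* (d :+ con true))) := t :* (a :+ d)) refl a d t ⟩
      t * (a + d)   ≡⟨ cong (t *_) tru ⟩
      t * 0#        ≡⟨ zeroʳ t ⟩
      0#            ∎
      where open ≡-Reasoning

    det-pencil : ∀ u t → Det u ≡ 1# → tr u ≡ 0# → Det (pencil u t) ≡ 1#
    det-pencil (mat a b c d) t detu tru = begin
      ((1# + (t * (a + 1#))) * (1# + (t * (d + 1#)))) + (- ((t * b) * (t * c)))
        ≡⟨ solve 5 (λ a b c d t → ((con true :+ (t :* (a :+ con true))) :* (con true :+ (t :* (d :+ con true)))) :+ (:- ((t :* b) :* (t :* c)))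
            := (con true :+ ((t :* (a :+ d)) :* (con true :+ t))) :+ ((t :* t) :* (((a :* d) :+ (:- (b :* c))) :+ con true))) refl a b c d t ⟩
      (1# + ((t * (a + d)) * (1# + t))) + ((t * t) * (((a * d) + (- (b * c))) + 1#))
        ≡⟨ cong₂ (λ x y → (1# + ((t * x) * (1# + t))) + ((t * t) * (y + 1#))) tru detu ⟩
      (1# + ((t * 0#) * (1# + t))) + ((t * t) * (1# + 1#))
        ≡⟨ solve 1 (λ t → (con true :+ ((t :* con false) :* (con true :+ t))) :+ ((t :* t) :* (con true :+ con true)) := con true) refl t ⟩
      1# ∎
      where open ≡-Reasoning

  -- The matrix u + I squares to zero, so the `s * t` term of the product vanishes. The pencil is
  -- thus an elementary abelian 2-group parametrized by the additive group of the field.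
  pencil-+ : ∀ u s t → tr u ≡ 0# → Det u ≡ 1# → pencil u s ⊗ pencil u t ≡ pencil u (s + t)
  pencil-+ (mat a b c d) s t tru detu with x+y≡0⇒x≡y a d tru
  ... | refl = mat-cong
    (trans (solve 5 (λ a b c s t → ((con true :+ (s :* (a :+ con true))) :* (con true :+ (t :* (a :+ con true)))) :+ ((s :* b) :* (t :* c))
          := (con true :+ ((s :+ t) :* (a :+ con true))) :+ ((s :* t) :* (con true :+ ((a :* a) :+ (:- (b :* c)))))) refl a b c s t)
       (trans (cong (λ z → (1# + ((s + t) * (a + 1#))) + ((s * t) * (1# + z))) detu) (kill _ (s * t))))
    (solve 4 (λ a b s t → ((con true :+ (s :* (a :+ con true))) :* (t :* b)) :+ ((s :* b) :* (con true :+ (t :* (a :+ con true)))) := (s :+ t) :* b) refl a b s t)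
    (solve 4 (λ a c s t → ((s :* c) :* (con true :+ (t :* (a :+ con true)))) :+ ((con true :+ (s :* (a :+ con true))) :* (t :* c)) := (s :+ t) :* c) refl a c s t)
    (trans (solve 5 (λ a b c s t → ((s :* c) :* (t :* b)) :+ ((con true :+ (s :* (a :+ con true))) :* (con true :+ (t :* (a :+ con true))))
          := (con true :+ ((s :+ t) :* (a :+ con true))) :+ ((s :* t) :* (con true :+ ((a :* a) :+ (:- (b :* c)))))) refl a b c s t)
       (trans (cong (λ z → (1# + ((s + t) * (a + 1#))) + ((s * t) * (1# + z))) detu) (kill _ (s * t))))
    where
    kill : ∀ x y → x + (y * (1# + 1#)) ≡ x
    kill = solve 2 (λ x y → x :+ (y :* (con true :+ con true)) := x) refl
  abstract
    ⊗-assoc : ∀ A B C → (A ⊗ B) ⊗ C ≡ A ⊗ (B ⊗ C)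
    ⊗-assoc (mat a b c d) (mat a' b' c' d') (mat a″ b″ c″ d″) = mat-cong
      (entry a b a″ c″) (entry a b b″ d″) (entry c d a″ c″) (entry c d b″ d″)
      where
      entry : ∀ x y z w → (((x * a') + (y * c')) * z) + (((x * b') + (y * d')) * w)
                        ≡ (x * ((a' * z) + (b' * w))) + (y * ((c' * z) + (d' * w)))
      entry = solve 8 (λ a' b' c' d' x y z w →
        (((x :* a') :+ (y :* c')) :* z) :+ (((x :* b') :+ (y :* d')) :* w)
        := (x :* ((a' :* z) :+ (b' :* w))) :+ (y :* ((c' :* z) :+ (d' :* w)))) refl a' b' c' d'

    ⊗-identityˡ : ∀ A → I ⊗ A ≡ A
    ⊗-identityˡ (mat a b c d) = mat-cong (one a c) (one b d) (two a c) (two b d)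
      where
      one : ∀ x y → (1# * x) + (0# * y) ≡ x
      one = solve 2 (λ x y → (con true :* x) :+ (con false :* y) := x) refl
      two : ∀ x y → (0# * x) + (1# * y) ≡ y
      two = solve 2 (λ x y → (con false :* x) :+ (con true :* y) := y) refl

    ⊗-identityʳ : ∀ A → A ⊗ I ≡ A
    ⊗-identityʳ (mat a b c d) = mat-cong (one a b) (two a b) (one c d) (two c d)
      where
      one : ∀ x y → (x * 1#) + (y * 0#) ≡ x
      one = solve 2 (λ x y → (x :* con true) :+ (y :* con false) := x) refl
      two : ∀ x y → (x * 0#) + (y * 1#) ≡ y
      two = solve 2 (λ x y → (x :* con false) :+ (y :* con true) := y) refl

  -- Made total, with value 0 at 0, so that terms containing a quotient carry no proof of
  -- nonvanishing.
  recip : Fin q → Fin q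
  recip x with x ≟ 0#
  ... | yes _   = 0#
  ... | no  x≢0 = proj₁ (inverse x x≢0)

  abstract
    recip-inverse : ∀ x → x ≢ 0# → x * recip x ≡ 1#
    recip-inverse x x≢0 with x ≟ 0#
    ... | yes x≡0  = contradiction x≡0 x≢0
    ... | no  x≢0′ = proj₂ (inverse x x≢0′)

    *-recip-cancel : ∀ x y → y ≢ 0# → (x * recip y) * y ≡ x
    *-recip-cancel x y y≢0 = begin
      (x * recip y) * y   ≡⟨ solve 3 (λ x r y → (x :* r) :* y := x :* (y :* r)) refl x (recip y) y ⟩
      x * (y * recip y)   ≡⟨ cong (x *_) (recip-inverse y y≢0) ⟩
      x * 1#              ≡⟨ *-identityʳ x ⟩
      x                   ∎
      where open ≡-Reasoning

    *-cancelˡ : ∀ x y z → x ≢ 0# → x * y ≡ x * z → y ≡ z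
    *-cancelˡ x y z x≢0 xy≡xz = x+y≡0⇒x≡y y z (*-zero⇒zero x (y + z) x≢0
      (trans (distribˡ x y z) (trans (cong (_+ (x * z)) xy≡xz) (x+x≡0 (x * z)))))

    x*x≡1⇒x≡1 : ∀ x → x * x ≡ 1# → x ≡ 1#
    x*x≡1⇒x≡1 x xx≡1 = square-injective x 1# (trans xx≡1 (sym (*-identityˡ 1#)))

  -- Comparing determinants gives `x * x ≡ 1#`, and 1 is its only square root of 1. Projective
  -- coincidences between elements of SL are therefore equalities.
  scalar-in-SL : ∀ x A B → Det A ≡ 1# → Det B ≡ 1# → A ≡ x • B → A ≡ B
  scalar-in-SL x A B detA detB A≡xB = trans A≡xB (trans (cong (_• B) x≡1) (1•A B))
    where
    open ≡-Reasoning
    x≡1 : x ≡ 1#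
    x≡1 = x*x≡1⇒x≡1 x (begin
      x * x             ≡⟨ *-identityʳ _ ⟨
      (x * x) * 1#      ≡⟨ cong ((x * x) *_) detB ⟨
      (x * x) * Det B   ≡⟨ det-• x B ⟨
      Det (x • B)       ≡⟨ cong Det A≡xB ⟨
      Det A             ≡⟨ detA ⟩
      1#                ∎)

  -- Homogeneous coordinates (x : y) on the projective line.
  direction : Fin q → Fin q → Fin (suc q)
  direction x y with y ≟ 0#
  ... | yes _ = zero
  ... | no  _ = suc (x * recip y)

  direction-injective : ∀ x y x' y' → ¬ (x ≡ 0# × y ≡ 0#) → ¬ (x' ≡ 0# × y' ≡ 0#) →
    direction x y ≡ direction x' y' → ∃ λ l → x ≡ l * x' × y ≡ l * y'
  direction-injective x y x' y' ≢0 ≢0′ eq with y ≟ 0# | y' ≟ 0#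
  ... | yes refl | yes refl = x * recip x' , sym (*-recip-cancel x x' λ x'≡0 → ≢0′ (x'≡0 , refl)) , sym (zeroʳ _)
  ... | no  y≢0  | no  y'≢0 = y * recip y' , (begin
    x                       ≡⟨ *-recip-cancel x y y≢0 ⟨
    (x * recip y) * y       ≡⟨ cong (_* y) (Fin.suc-injective eq) ⟩
    (x' * recip y') * y     ≡⟨ solve 3 (λ x r y → (x :* r) :* y := (y :* r) :* x) refl x' (recip y') y ⟩
    (y * recip y') * x'     ∎) , sym (*-recip-cancel y y' y'≢0)
    where open ≡-Reasoning

  abstract
    tr-⊗ : ∀ m b' c' a b c d → tr (mat m b' c' m ⊗ mat a b c d) ≡ (m * (a + d)) + ((b' * c) + (c' * b))
    tr-⊗ = solve 7 (λ m b' c' a b c d → ((m :* a) :+ (b' :* c)) :+ ((c' :* b) :+ (m :* d)) := (m :* (a :+ d)) :+ ((b' :* c) :+ (c' :* b))) refl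

  -- Both diagonal entries equal some a with a² = 1 + bc, and square roots are unique in
  -- characteristic 2.
  tr-det-determined : ∀ A B → Det A ≡ 1# → Det B ≡ 1# → tr A ≡ 0# → tr B ≡ 0# →
    Mat2.b A ≡ Mat2.b B → Mat2.c A ≡ Mat2.c B → A ≡ B
  tr-det-determined (mat a b c d) (mat a' .b .c d') detA detB trA trB refl refl
    with x+y≡0⇒x≡y a d trA | x+y≡0⇒x≡y a' d' trB
  ... | refl | refl = mat-cong a≡a' refl refl a≡a'
    where
    a≡a' : a ≡ a'
    a≡a' = square-injective a a' (+-cancelʳ (- (b * c)) _ _ (trans detA (sym detB)))

  pencil-0 : ∀ u → pencil u 0# ≡ I
  pencil-0 (mat a b c d) = mat-cong (eq a) (zeroˡ b) (zeroˡ c) (eq d)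
    where
    eq : ∀ x → 1# + (0# * (x + 1#)) ≡ 1#
    eq = solve 1 (λ x → con true :+ (con false :* (x :+ con true)) := con true) refl

  pencil-1 : ∀ u → pencil u 1# ≡ u
  pencil-1 (mat a b c d) = mat-cong (eq a) (*-identityˡ b) (*-identityˡ c) (eq d)
    where
    eq : ∀ x → 1# + (1# * (x + 1#)) ≡ x
    eq = solve 1 (λ x → con true :+ (con true :* (x :+ con true)) := x) refl

  pencil≡I : ∀ u t → t ≢ 0# → pencil u t ≡ I → u ≡ I
  pencil≡I (mat a b c d) t t≢0 eq = mat-cong (diagonal a (cong Mat2.a eq))
    (*-zero⇒zero t b t≢0 (cong Mat2.b eq)) (*-zero⇒zero t c t≢0 (cong Mat2.c eq))
    (diagonal d (cong Mat2.d eq))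
    where
    diagonal : ∀ x → 1# + (t * (x + 1#)) ≡ 1# → x ≡ 1#
    diagonal x eq = x+y≡0⇒x≡y x 1# (*-zero⇒zero t (x + 1#) t≢0
      (+-cancelˡ 1# _ _ (trans eq (sym (+-identityʳ 1#)))))

  -- The pencil is affine in `u`, so either product is the same function of `X` and of the product
  -- of `X` with `u`.
  pencil-commutes : ∀ X u t → X ⊗ u ≡ u ⊗ X → X ⊗ pencil u t ≡ pencil u t ⊗ X
  pencil-commutes X u t Xu≡uX = trans (left X u) (trans (cong (affine X) Xu≡uX) (sym (right X u)))
    where
    affine : Mat → Mat → Mat
    affine (mat x y z w) (mat x' y' z' w') =
      mat ((x + (t * x)) + (t * x')) ((y + (t * y)) + (t * y')) ((z + (t * z)) + (t * z')) ((w + (t * w)) + (t * w'))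
    left₁ : ∀ t x y a c → (x * (1# + (t * (a + 1#)))) + (y * (t * c)) ≡ (x + (t * x)) + (t * ((x * a) + (y * c)))
    left₁ = solve 5 (λ t x y a c → (x :* (con true :+ (t :* (a :+ con true)))) :+ (y :* (t :* c)) := (x :+ (t :* x)) :+ (t :* ((x :* a) :+ (y :* c)))) refl
    left₂ : ∀ t x y b d → (x * (t * b)) + (y * (1# + (t * (d + 1#)))) ≡ (y + (t * y)) + (t * ((x * b) + (y * d)))
    left₂ = solve 5 (λ t x y b d → (x :* (t :* b)) :+ (y :* (con true :+ (t :* (d :+ con true)))) := (y :+ (t :* y)) :+ (t :* ((x :* b) :+ (y :* d)))) refl
    right₁ : ∀ t a b x z → ((1# + (t * (a + 1#))) * x) + ((t * b) * z) ≡ (x + (t * x)) + (t * ((a * x) + (b * z)))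
    right₁ = solve 5 (λ t a b x z → ((con true :+ (t :* (a :+ con true))) :* x) :+ ((t :* b) :* z) := (x :+ (t :* x)) :+ (t :* ((a :* x) :+ (b :* z)))) refl
    right₂ : ∀ t c d x z → ((t * c) * x) + ((1# + (t * (d + 1#))) * z) ≡ (z + (t * z)) + (t * ((c * x) + (d * z)))
    right₂ = solve 5 (λ t c d x z → ((t :* c) :* x) :+ ((con true :+ (t :* (d :+ con true))) :* z) := (z :+ (t :* z)) :+ (t :* ((c :* x) :+ (d :* z)))) refl
    left : ∀ X u → X ⊗ pencil u t ≡ affine X (X ⊗ u)
    left (mat x y z w) (mat a b c d) = mat-cong (left₁ t x y a c) (left₂ t x y b d) (left₁ t z w a c) (left₂ t z w b d)
    right : ∀ X u → pencil u t ⊗ X ≡ affine X (u ⊗ X)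
    right (mat x y z w) (mat a b c d) = mat-cong (right₁ t a b x z) (right₁ t a b y w) (right₂ t c d x z) (right₂ t c d y w)

  -- Commuting with `u` makes the off-diagonal part of `X` proportional to that of `u`, and makes
  -- `b` and `c` annihilate the trace of `X`. As `u` is not I, `b` or `c` is nonzero; so `X` has
  -- trace 0 and is determined by its off-diagonal entries.
  centralizer⊆pencil : ∀ u X → Det u ≡ 1# → tr u ≡ 0# → u ≢ I → Det X ≡ 1# → X ⊗ u ≡ u ⊗ X →
    ∃ λ t → X ≡ pencil u t
  centralizer⊆pencil (mat a b c d) (mat x y z w) detu tru u≢I detX comm
    with x+y≡0⇒x≡y a d tru
  ... | refl = by-cases (b ≟ 0#) (c ≟ 0#)
    where
    u = mat a b c a
    X = mat x y z w
    yc≡bz : y * c ≡ b * z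
    yc≡bz = +-cancelˡ (x * a) _ _ (trans (cong Mat2.a comm) (cong (_+ (b * z)) (*-comm a x)))
    b*tr≡0 : b * (x + w) ≡ 0#
    b*tr≡0 = trans (solve 5 (λ a b x y w → b :* (x :+ w) := ((x :* b) :+ (y :* a)) :+ ((a :* y) :+ (b :* w))) refl a b x y w)
                   (trans (cong (_+ ((a * y) + (b * w))) (cong Mat2.b comm)) (x+x≡0 _))
    c*tr≡0 : c * (x + w) ≡ 0#
    c*tr≡0 = trans (solve 5 (λ a c x z w → c :* (x :+ w) := ((z :* a) :+ (w :* c)) :+ ((c :* x) :+ (a :* z))) refl a c x z w)
                   (trans (cong (_+ ((c * x) + (a * z))) (cong Mat2.c comm)) (x+x≡0 _))
    on-pencil : ∀ t → x + w ≡ 0# → y ≡ t * b → z ≡ t * c → ∃ λ t → X ≡ pencil u t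
    on-pencil t trX y≡ z≡ = t , tr-det-determined X (pencil u t) detX (det-pencil u t detu tru) trX (tr-pencil u t tru) y≡ z≡
    by-cases : Dec (b ≡ 0#) → Dec (c ≡ 0#) → ∃ λ t → X ≡ pencil u t
    by-cases (no b≢0) _ = on-pencil (y * recip b) (*-zero⇒zero b _ b≢0 b*tr≡0) (sym (*-recip-cancel y b b≢0))
      (*-cancelˡ b _ _ b≢0 (trans (sym yc≡bz) (trans (cong (_* c) (sym (*-recip-cancel y b b≢0)))
        (solve 3 (λ s b c → (s :* b) :* c := b :* (s :* c)) refl (y * recip b) b c))))
    by-cases (yes _) (no c≢0) = on-pencil (z * recip c) (*-zero⇒zero c _ c≢0 c*tr≡0)
      (*-cancelˡ c _ _ c≢0 (trans (*-comm c y) (trans yc≡bz (trans (cong (b *_) (sym (*-recip-cancel z c c≢0)))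
        (solve 3 (λ s b c → b :* (s :* c) := c :* (s :* b)) refl (z * recip c) b c)))))
      (sym (*-recip-cancel z c c≢0))
    by-cases (yes b≡0) (yes c≡0) = contradiction
      (tr-det-determined u I detu det-I tru (1+1≡0) b≡0 c≡0) u≢I

  abstract
    tr-conjugate : ∀ A u → tr (adj A ⊗ (u ⊗ A)) ≡ Det A * tr u
    tr-conjugate (mat x y z w) (mat a b c d) = solve 8 (λ x y z w a b c d →
      ((w :* ((a :* x) :+ (b :* z))) :+ (y :* ((c :* x) :+ (d :* z)))) :+ ((z :* ((a :* y) :+ (b :* w))) :+ (x :* ((c :* y) :+ (d :* w))))
      := ((x :* w) :+ (:- (y :* z))) :* (a :+ d)) refl x y z w a b c d

  adj-inverseʳ : ∀ A → Det A ≡ 1# → A ⊗ adj A ≡ I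
  adj-inverseʳ A detA = adj-inverse (adj A) (trans (det-adj A) detA)

  conjugate-cancel : ∀ (g : SL) u → proj₁ g ⊗ (adj (proj₁ g) ⊗ (u ⊗ proj₁ g)) ≡ u ⊗ proj₁ g
  conjugate-cancel (g , detg) u = trans (sym (⊗-assoc g (adj g) (u ⊗ g)))
    (trans (cong (_⊗ (u ⊗ g)) (adj-inverseʳ g detg)) (⊗-identityˡ (u ⊗ g)))

  conjugate≡I : ∀ (g : SL) u → adj (proj₁ g) ⊗ (u ⊗ proj₁ g) ≡ I → u ≡ I
  conjugate≡I (g , detg) u eq = begin
    u                   ≡⟨ ⊗-identityʳ u ⟨
    u ⊗ I               ≡⟨ cong (u ⊗_) (adj-inverseʳ g detg) ⟨
    u ⊗ (g ⊗ adj g)     ≡⟨ ⊗-assoc u g (adj g) ⟨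
    (u ⊗ g) ⊗ adj g     ≡⟨ cong (_⊗ adj g) (conjugate-cancel (g , detg) u) ⟨
    (g ⊗ (adj g ⊗ (u ⊗ g))) ⊗ adj g   ≡⟨ cong (λ Z → (g ⊗ Z) ⊗ adj g) eq ⟩
    (g ⊗ I) ⊗ adj g     ≡⟨ cong (_⊗ adj g) (⊗-identityʳ g) ⟩
    g ⊗ adj g           ≡⟨ adj-inverseʳ g detg ⟩
    I                   ∎
    where open ≡-Reasoning

  -- If g and the inverse of s conjugate `u` to the same element, then g s centralizes `u`.
  conjugator-commutes : ∀ (g s : SL) u → proj₁ s ⊗ u ≡ (adj (proj₁ g) ⊗ (u ⊗ proj₁ g)) ⊗ proj₁ s →
    (proj₁ g ⊗ proj₁ s) ⊗ u ≡ u ⊗ (proj₁ g ⊗ proj₁ s)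
  conjugator-commutes (g , detg) (s , _) u su≡Ys = begin
    (g ⊗ s) ⊗ u                         ≡⟨ ⊗-assoc g s u ⟩
    g ⊗ (s ⊗ u)                         ≡⟨ cong (g ⊗_) su≡Ys ⟩
    g ⊗ ((adj g ⊗ (u ⊗ g)) ⊗ s)         ≡⟨ ⊗-assoc g (adj g ⊗ (u ⊗ g)) s ⟨
    (g ⊗ (adj g ⊗ (u ⊗ g))) ⊗ s         ≡⟨ cong (_⊗ s) (conjugate-cancel (g , detg) u) ⟩
    (u ⊗ g) ⊗ s                         ≡⟨ ⊗-assoc u g s ⟩
    u ⊗ (g ⊗ s)                         ∎
    where open ≡-Reasoning

  -- The determinant of a scalar matrix is a square, and only 1 squares to 1. This is the triviality
  -- of the centre that identifies PSL with SL.
  scalar⇒I : ∀ A → Det A ≡ 1# → IsScalar F A → A ≡ I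
  scalar⇒I (mat a b c d) detA (refl , refl , refl) = mat-cong a≡1 refl refl a≡1
    where
    a≡1 : a ≡ 1#
    a≡1 = x*x≡1⇒x≡1 a (trans (solve 1 (λ a → a :* a := (a :* a) :+ (:- (con false :* con false))) refl a) detA)

  quotient≡I : ∀ (A B : SL) → adj (proj₁ B) ⊗ proj₁ A ≡ I → proj₁ A ≡ proj₁ B
  quotient≡I (A , _) (B , detB) eq = begin
    A                 ≡⟨ ⊗-identityˡ A ⟨
    I ⊗ A             ≡⟨ cong (_⊗ A) (adj-inverseʳ B detB) ⟨
    (B ⊗ adj B) ⊗ A   ≡⟨ ⊗-assoc B (adj B) A ⟩
    B ⊗ (adj B ⊗ A)   ≡⟨ cong (B ⊗_) eq ⟩
    B ⊗ I             ≡⟨ ⊗-identityʳ B ⟩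
    B                 ∎
    where open ≡-Reasoning

  -- Orthogonality to both `I` and `A` for the trace form, which sends a pair of matrices to the
  -- trace of their product.
  _⟂_ : Mat → Mat → Set
  M ⟂ A = tr M ≡ 0# × tr (M ⊗ A) ≡ 0#

  0M : Mat
  0M = mat 0# 0# 0# 0#

  abstract
    0•A : ∀ A → 0# • A ≡ 0M
    0•A (mat a b c d) = mat-cong (zeroˡ a) (zeroˡ b) (zeroˡ c) (zeroˡ d)

    det-0M : Det 0M ≡ 0#
    det-0M = solve 0 ((con false :* con false) :+ (:- (con false :* con false)) := con false) refl

  nilpotent : Mat → Mat
  nilpotent (mat a b c d) = mat (a + 1#) b c (d + 1#)

  abstract
    tr-nilpotent : ∀ u → tr (nilpotent u) ≡ tr u
    tr-nilpotent (mat a b c d) = solve 2 (λ a d → (a :+ con true) :+ (d :+ con true) := a :+ d) refl a d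

    det-nilpotent : ∀ u → Det u ≡ 1# → tr u ≡ 0# → Det (nilpotent u) ≡ 0#
    det-nilpotent (mat a b c d) detu tru = begin
      ((a + 1#) * (d + 1#)) + (- (b * c))
        ≡⟨ solve 4 (λ a b c d → ((a :+ con true) :* (d :+ con true)) :+ (:- (b :* c)) := (((a :* d) :+ (:- (b :* c))) :+ con true) :+ (a :+ d)) refl a b c d ⟩
      (Det (mat a b c d) + 1#) + (a + d)   ≡⟨ cong₂ (λ y z → (y + 1#) + z) detu tru ⟩
      (1# + 1#) + 0#                       ≡⟨ trans (+-identityʳ _) 1+1≡0 ⟩
      0#                                   ∎
      where open ≡-Reasoning

    tr-pencil-⊗ : ∀ u t A → tr (pencil u t ⊗ A) ≡ tr A + (t * tr (nilpotent u ⊗ A))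
    tr-pencil-⊗ (mat a b c d) t (mat a' b' c' d') = solve 9 (λ t a b c d a' b' c' d' →
      (((con true :+ (t :* (a :+ con true))) :* a') :+ ((t :* b) :* c')) :+ (((t :* c) :* b') :+ ((con true :+ (t :* (d :+ con true))) :* d'))
      := (a' :+ d') :+ (t :* ((((a :+ con true) :* a') :+ (b :* c')) :+ ((c :* b') :+ ((d :+ con true) :* d')))))
      refl t a b c d a' b' c' d'

  nilpotent≡0⇒≡I : ∀ u → nilpotent u ≡ 0M → u ≡ I
  nilpotent≡0⇒≡I (mat a b c d) eq = mat-cong (x+y≡0⇒x≡y a 1# (cong Mat2.a eq)) (cong Mat2.b eq)
    (cong Mat2.c eq) (x+y≡0⇒x≡y d 1# (cong Mat2.d eq))

  -- The space of all M ⟂ A has the off-diagonal entries of M as coordinates.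
  ⟂-determined : ∀ A M M' → tr A ≢ 0# → M ⟂ A → M' ⟂ A → ∀ l →
    Mat2.b M ≡ l * Mat2.b M' → Mat2.c M ≡ l * Mat2.c M' → M ≡ l • M'
  ⟂-determined (mat a b c d) (mat m x y n) (mat m' x' y' n') trA≢0 (trM , trMA) (trM' , trM'A) l refl refl
    with x+y≡0⇒x≡y m n trM | x+y≡0⇒x≡y m' n' trM'
  ... | refl | refl = mat-cong m≡lm' refl refl m≡lm'
    where
    open ≡-Reasoning
    e = a + d
    -- Since `e`, the trace of `A`, is nonzero, the condition tr (M A) = 0 can be solved for the
    -- diagonal entry of M.
    diagonal : ∀ m x y → tr (mat m x y m ⊗ mat a b c d) ≡ 0# → e * m ≡ (x * c) + (y * b)
    diagonal m x y eq = trans (*-comm e m) (x+y≡0⇒x≡y _ _ (trans (sym (tr-⊗ m x y a b c d)) eq))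
    m≡lm' : m ≡ l * m'
    m≡lm' = *-cancelˡ e m (l * m') trA≢0 (begin
      e * m                                ≡⟨ diagonal m _ _ trMA ⟩
      ((l * x') * c) + ((l * y') * b)      ≡⟨ solve 5 (λ l x y c b → ((l :* x) :* c) :+ ((l :* y) :* b) := l :* ((x :* c) :+ (y :* b))) refl l x' y' c b ⟩
      l * ((x' * c) + (y' * b))            ≡⟨ cong (l *_) (diagonal m' x' y' trM'A) ⟨
      l * (e * m')                         ≡⟨ solve 3 (λ l e m → l :* (e :* m) := e :* (l :* m)) refl l e m' ⟩
      e * (l * m')                         ∎)

  -- Dihedral subgroups of order 2(q + 1) in SL(2,q).

  module Dihedral (k : ℕ) (k*2≡q : k ℕ.* 2 ≡ q)
           (δ : Fin (suc q) × Bool → SL)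
           (δ-hom : ∀ c d → proj₁ (δ (DihedralMul q c d)) ≡ proj₁ (δ c) ⊗ proj₁ (δ d))
           (δ-inj : ∀ c d → proj₁ (δ c) ≡ proj₁ (δ d) → c ≡ d) where
    private
      n = suc q

      m : Fin n × Bool → Mat
      m c = proj₁ (δ c)

      toℕ-mod : ∀ i → toℕ (i mod n) ≡ i ℕ.% n
      toℕ-mod i = Fin.toℕ-fromℕ< _

      ρ : Fin n → Mat
      ρ a = m (a , false)

      reflection : Fin n → Mat
      reflection a = m (a , true)

      0-mod : ∀ i → i ℕ.% n ≡ 0 → i mod n ≡ zero
      0-mod i eq = Fin.toℕ-injective (trans (toℕ-mod i) eq)

      idempotent⇒I : ∀ (A : SL) → proj₁ A ⊗ proj₁ A ≡ proj₁ A → proj₁ A ≡ I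
      idempotent⇒I (A , detA) AA≡A = begin
        A                 ≡⟨ ⊗-identityˡ A ⟨
        I ⊗ A             ≡⟨ cong (_⊗ A) (adj-inverse A detA) ⟨
        (adj A ⊗ A) ⊗ A   ≡⟨ ⊗-assoc (adj A) A A ⟩
        adj A ⊗ (A ⊗ A)   ≡⟨ cong (adj A ⊗_) AA≡A ⟩
        adj A ⊗ A         ≡⟨ adj-inverse A detA ⟩
        I                 ∎
        where open ≡-Reasoning

      ρ0≡I : ρ zero ≡ I
      ρ0≡I = idempotent⇒I (δ (zero , false))
        (trans (sym (δ-hom (zero , false) (zero , false))) (cong ρ (0-mod 0 refl)))

      reflection² : ∀ a → reflection a ⊗ reflection a ≡ I
      reflection² a = trans (sym (δ-hom (a , true) (a , true))) (trans (cong ρ (0-mod (toℕ a ℕ.+ (n ℕ.∸ toℕ a)) eq)) ρ0≡I)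
        where
        eq : (toℕ a ℕ.+ (n ℕ.∸ toℕ a)) ℕ.% n ≡ 0
        eq = trans (cong (ℕ._% n) (ℕ.m+[n∸m]≡n (ℕ.<⇒≤ (Fin.toℕ<n a)))) (n%n≡0 n)

      reflection≢I : ∀ a → reflection a ≢ I
      reflection≢I a eq = contradiction (cong proj₂ (δ-inj (a , true) (zero , false) (trans eq (sym ρ0≡I)))) λ ()

      reflection-reflection : ∀ a b → ∃ λ c → reflection a ⊗ reflection b ≡ ρ c
      reflection-reflection a b = _ , sym (δ-hom (a , true) (b , true))

      reflection-ρ : ∀ a b → ∃ λ c → reflection a ⊗ ρ b ≡ reflection c
      reflection-ρ a b = _ , sym (δ-hom (a , true) (b , false))

      ρ-injective : ∀ {a b} → ρ a ≡ ρ b → a ≡ b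
      ρ-injective {a} {b} eq = cong proj₁ (δ-inj (a , false) (b , false) eq)

      -- The order n = q + 1 of the rotation subgroup is odd, with k + 1 inverse to 2 modulo n.
      half-identity : ∀ i → i ℕ.* suc k ℕ.+ i ℕ.* suc k ≡ i ℕ.+ i ℕ.* n
      half-identity i = trans (ℕsolve 2
        (λ i k → i ℕ:* (ℕcon 1 ℕ:+ k) ℕ:+ i ℕ:* (ℕcon 1 ℕ:+ k) ℕ:= i ℕ:+ i ℕ:* (ℕcon 1 ℕ:+ k ℕ:* ℕcon 2)) refl i k)
        (cong (λ z → i ℕ.+ i ℕ.* suc z) k*2≡q)

      ρ²≡I⇒ρ≡I : ∀ a → ρ a ⊗ ρ a ≡ I → ρ a ≡ I
      ρ²≡I⇒ρ≡I a ρρ≡I = trans (cong ρ a≡0) ρ0≡I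
        where
        2a≡0 : (toℕ a ℕ.+ toℕ a) ℕ.% n ≡ 0
        2a≡0 = trans (sym (toℕ-mod (toℕ a ℕ.+ toℕ a))) (cong toℕ (ρ-injective {(toℕ a ℕ.+ toℕ a) mod n} {zero}
          (trans (δ-hom (a , false) (a , false)) (trans ρρ≡I (sym ρ0≡I)))))
        n∣a+an : n ∣ toℕ a ℕ.* n ℕ.+ toℕ a
        n∣a+an = subst (n ∣_)
          (trans (ℕ.*-distribʳ-+ (suc k) (toℕ a) (toℕ a)) (trans (half-identity (toℕ a)) (ℕ.+-comm (toℕ a) _)))
          (∣-trans (m%n≡0⇒n∣m (toℕ a ℕ.+ toℕ a) n 2a≡0) (m∣m*n (suc k)))
        a≡0 : a ≡ zero
        a≡0 = Fin.toℕ-injective (trans (sym (m<n⇒m%n≡m (Fin.toℕ<n a)))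
          (n∣m⇒m%n≡0 (toℕ a) n (∣m+n∣m⇒∣n n∣a+an (n∣m*n (toℕ a)))))

      ρ-root : ∀ a → ∃ λ s → ρ s ⊗ ρ s ≡ ρ a
      ρ-root a = (toℕ a ℕ.* suc k) mod n , trans (sym (δ-hom _ _)) (cong ρ (Fin.toℕ-injective (begin
        toℕ ((toℕ s ℕ.+ toℕ s) mod n)    ≡⟨ toℕ-mod (toℕ s ℕ.+ toℕ s) ⟩
        (toℕ s ℕ.+ toℕ s) ℕ.% n          ≡⟨ cong (λ z → (z ℕ.+ z) ℕ.% n) (toℕ-mod x) ⟩
        (x ℕ.% n ℕ.+ x ℕ.% n) ℕ.% n      ≡⟨ %-distribˡ-+ x x n ⟨
        (x ℕ.+ x) ℕ.% n                  ≡⟨ cong (ℕ._% n) (half-identity (toℕ a)) ⟩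
        (toℕ a ℕ.+ toℕ a ℕ.* n) ℕ.% n    ≡⟨ [m+kn]%n≡m%n (toℕ a) (toℕ a) n ⟩
        toℕ a ℕ.% n                      ≡⟨ m<n⇒m%n≡m (Fin.toℕ<n a) ⟩
        toℕ a                            ∎)))
        where
        open ≡-Reasoning
        x = toℕ a ℕ.* suc k
        s = x mod n

    In : Mat → Set
    In A = ∃ λ c → proj₁ (δ c) ≡ A

    private
      -- The rotation subgroup has odd order, so it contains no involution.
      involution⇒reflection : ∀ X → In X → X ⊗ X ≡ I → X ≢ I → ∃ λ a → reflection a ≡ X
      involution⇒reflection X ((a , true)  , eq) _ _ = a , eq
      involution⇒reflection X ((a , false) , refl) XX≡I X≢I = contradiction (ρ²≡I⇒ρ≡I a XX≡I) X≢I

    -- Both are reflections, so `X ⊗ Y` is a rotation; commutation makes its square I, and odd order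
    -- then makes it I.
    commuting-involutions-equal : ∀ X Y → In X → In Y → X ⊗ X ≡ I → Y ⊗ Y ≡ I → X ≢ I → Y ≢ I →
      X ⊗ Y ≡ Y ⊗ X → X ≡ Y
    commuting-involutions-equal X Y X∈ Y∈ XX YY X≢I Y≢I comm
      with involution⇒reflection X X∈ XX X≢I | involution⇒reflection Y Y∈ YY Y≢I
    ... | a , refl | b , refl = begin
      X               ≡⟨ ⊗-identityʳ X ⟨
      X ⊗ I           ≡⟨ cong (X ⊗_) XY≡I ⟨
      X ⊗ (X ⊗ Y)     ≡⟨ ⊗-assoc X X Y ⟨
      (X ⊗ X) ⊗ Y     ≡⟨ cong (_⊗ Y) XX ⟩
      I ⊗ Y           ≡⟨ ⊗-identityˡ Y ⟩
      Y               ∎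
      where
      open ≡-Reasoning
      XYXY≡I : (X ⊗ Y) ⊗ (X ⊗ Y) ≡ I
      XYXY≡I = begin
        (X ⊗ Y) ⊗ (X ⊗ Y)   ≡⟨ cong ((X ⊗ Y) ⊗_) comm ⟩
        (X ⊗ Y) ⊗ (Y ⊗ X)   ≡⟨ ⊗-assoc X Y (Y ⊗ X) ⟩
        X ⊗ (Y ⊗ (Y ⊗ X))   ≡⟨ cong (X ⊗_) (⊗-assoc Y Y X) ⟨
        X ⊗ ((Y ⊗ Y) ⊗ X)   ≡⟨ cong (λ Z → X ⊗ (Z ⊗ X)) YY ⟩
        X ⊗ (I ⊗ X)         ≡⟨ cong (X ⊗_) (⊗-identityˡ X) ⟩
        X ⊗ X               ≡⟨ XX ⟩
        I                   ∎
      XY≡ρ : X ⊗ Y ≡ ρ (proj₁ (reflection-reflection a b))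
      XY≡ρ = proj₂ (reflection-reflection a b)
      XY≡I : X ⊗ Y ≡ I
      XY≡I = trans XY≡ρ (ρ²≡I⇒ρ≡I _ (trans (sym (cong₂ _⊗_ XY≡ρ XY≡ρ)) XYXY≡I))

    -- A square root s of the rotation Y X satisfies s X s = X, hence s X = Y s.
    involutions-conjugate : ∀ X Y → In X → In Y → X ⊗ X ≡ I → Y ⊗ Y ≡ I → X ≢ I → Y ≢ I →
      ∃ λ c → proj₁ (δ c) ⊗ X ≡ Y ⊗ proj₁ (δ c)
    involutions-conjugate X Y X∈ Y∈ XX YY X≢I Y≢I
      with involution⇒reflection X X∈ XX X≢I | involution⇒reflection Y Y∈ YY Y≢I
    ... | a , refl | b , refl = (s , false) , (begin
      σ ⊗ X               ≡⟨ cong (σ ⊗_) σXσ≡X ⟨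
      σ ⊗ (σ ⊗ (X ⊗ σ))   ≡⟨ ⊗-assoc σ σ _ ⟨
      (σ ⊗ σ) ⊗ (X ⊗ σ)   ≡⟨ cong (_⊗ (X ⊗ σ)) (trans (proj₂ (ρ-root c)) (sym YX≡ρ)) ⟩
      (Y ⊗ X) ⊗ (X ⊗ σ)   ≡⟨ ⊗-assoc Y X _ ⟩
      Y ⊗ (X ⊗ (X ⊗ σ))   ≡⟨ cong (Y ⊗_) (XX-cancel σ) ⟩
      Y ⊗ σ               ∎)
      where
      open ≡-Reasoning
      c = proj₁ (reflection-reflection b a)
      YX≡ρ = proj₂ (reflection-reflection b a)
      s = proj₁ (ρ-root c)
      σ = ρ s
      XX-cancel : ∀ Z → X ⊗ (X ⊗ Z) ≡ Z
      XX-cancel Z = trans (sym (⊗-assoc X X Z)) (trans (cong (_⊗ Z) XX) (⊗-identityˡ Z))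
      Xσ≡reflection = proj₂ (reflection-ρ a s)
      σXσ≡X : σ ⊗ (X ⊗ σ) ≡ X
      σXσ≡X = begin
        σ ⊗ (X ⊗ σ)               ≡⟨ XX-cancel _ ⟨
        X ⊗ (X ⊗ (σ ⊗ (X ⊗ σ)))   ≡⟨ cong (X ⊗_) (⊗-assoc X σ _) ⟨
        X ⊗ ((X ⊗ σ) ⊗ (X ⊗ σ))   ≡⟨ cong (X ⊗_) (trans (cong₂ _⊗_ Xσ≡reflection Xσ≡reflection) (reflection² _)) ⟩
        X ⊗ I                     ≡⟨ ⊗-identityʳ X ⟩
        X                         ∎

    -- All reflections are ⟂ to a fixed rotation A; there are q + 1 of them, one in each direction
    -- of the plane of matrices ⟂ to A.
    reflections-span : ∃ λ A → tr A ≢ 0# ×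
      (∀ M → M ⟂ A → M ≢ 0M →
        ∃ λ l → ∃ λ c → tr (proj₁ (δ c)) ≡ 0# × proj₁ (δ c) ≢ I × M ≡ l • proj₁ (δ c))
    reflections-span = A , trA≢0 , λ M M⟂A M≢0 →
      let x = Mat2.b M
          y = Mat2.c M
          M-coords≢0 = λ { (x≡0 , y≡0) → M≢0 (trans
            (⟂-determined A M M trA≢0 M⟂A M⟂A 0# (trans x≡0 (sym (zeroˡ x))) (trans y≡0 (sym (zeroˡ y)))) (0•A M)) }
          j , hit = injective⇒surjective {n} {n} refl dir dir-injective (direction x y)
          l , x≡ , y≡ = direction-injective x y _ _ M-coords≢0 (coords≢0 j) (sym hit)
      in l , (j , true) , involution⇒tr≡0 _ (reflection² j) , reflection≢I j ,
         ⟂-determined A M (reflection j) trA≢0 M⟂A (reflection⟂A j) l x≡ y≡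
      where
      open ≡-Reasoning
      one : Fin n
      one = 1 mod n
      A = ρ one
      ρ1≢I : A ≢ I
      ρ1≢I eq = 1≢0 (trans (sym 1%n) (trans (sym (toℕ-mod 1)) (cong toℕ (ρ-injective {one} {zero} (trans eq (sym ρ0≡I))))))
        where
        1%n : 1 ℕ.% n ≡ 1
        1%n = m<n⇒m%n≡m (ℕ.s≤s (ℕ.≤-trans (ℕ.s≤s ℕ.z≤n) (Fin.toℕ<n 0#)))
        1≢0 : 1 ≢ 0
        1≢0 ()
      -- A rotation of trace 0 would square to I, but the generator of a group of odd order q + 1 >
      -- 1 does not.
      trA≢0 : tr A ≢ 0#
      trA≢0 trA = ρ1≢I (ρ²≡I⇒ρ≡I one (tr≡0⇒involution A (proj₂ (δ (one , false))) trA))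
      -- A reflection times the rotation `A` is again a reflection, so both traces vanish.
      reflection⟂A : ∀ j → reflection j ⟂ A
      reflection⟂A j = involution⇒tr≡0 _ (reflection² j) ,
        trans (cong tr (proj₂ (reflection-ρ j one))) (involution⇒tr≡0 _ (reflection² _))
      coords≢0 : ∀ j → ¬ (Mat2.b (reflection j) ≡ 0# × Mat2.c (reflection j) ≡ 0#)
      coords≢0 j (b≡0 , c≡0) = 0≢1 (begin
        0#                  ≡⟨ det-0M ⟨
        Det 0M              ≡⟨ cong Det (0•A (reflection j)) ⟨
        Det (0# • reflection j) ≡⟨ cong Det (⟂-determined A _ _ trA≢0 (reflection⟂A j) (reflection⟂A j) 0#
                                   (trans b≡0 (sym (zeroˡ _))) (trans c≡0 (sym (zeroˡ _)))) ⟨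
        Det (reflection j)  ≡⟨ proj₂ (δ (j , true)) ⟩
        1#                  ∎)
      dir : Fin n → Fin n
      dir j = direction (Mat2.b (reflection j)) (Mat2.c (reflection j))
      -- Two reflections in the same direction are proportional matrices of determinant 1, hence
      -- equal.
      dir-injective : Injective _≡_ _≡_ dir
      dir-injective {i} {j} eq with direction-injective _ _ _ _ (coords≢0 i) (coords≢0 j) eq
      ... | l , b≡ , c≡ = cong proj₁ (δ-inj (i , true) (j , true)
              (scalar-in-SL l _ _ (proj₂ (δ (i , true))) (proj₂ (δ (j , true)))
                (⟂-determined A _ _ trA≢0 (reflection⟂A i) (reflection⟂A j) l b≡ c≡)))

-- Labels the two members of an unordered pair differently; it separates the two points in each
-- fibre of a two-to-one map.
side : ∀ {n} → Fin n → Fin n → Fin 2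
side a b with toℕ a ℕ.<? toℕ b
... | yes _ = zero
... | no  _ = suc zero

side-symmetric⇒≡ : ∀ {n} (a b : Fin n) → side a b ≡ side b a → a ≡ b
side-symmetric⇒≡ a b eq with toℕ a ℕ.<? toℕ b | toℕ b ℕ.<? toℕ a
... | yes a<b | yes b<a = contradiction b<a (ℕ.<⇒≯ a<b)
... | no  a≮b | no  b≮a = Fin.toℕ-injective (ℕ.≤-antisym (ℕ.≮⇒≥ b≮a) (ℕ.≮⇒≥ a≮b))

-- Actions of SL(2,q) in which every point stabilizer is dihedral of order 2(q + 1).

module DihedralAction
  {q′ : ℕ} (F : FieldOn (suc q′))
  (1+1≡0 : FieldOn._+_ F (FieldOn.1# F) (FieldOn.1# F) ≡ FieldOn.0# F)
  {k v : ℕ} (k*2≡q : k ℕ.* 2 ≡ suc q′) (v*2≡q[q-1] : v ℕ.* 2 ≡ suc q′ ℕ.* q′)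
  (act : SL2 F → Fin v → Fin v)
  (act-1 : ∀ A → proj₁ A ≡ mat (FieldOn.1# F) (FieldOn.0# F) (FieldOn.0# F) (FieldOn.1# F) → ∀ x → act A x ≡ x)
  (act-⊗ : ∀ A B C → proj₁ C ≡ matMul F (proj₁ A) (proj₁ B) → ∀ x → act C x ≡ act A (act B x))
  (stabilizer : ∀ x → Σ (Fin (suc (suc q′)) × Bool → SL2 F) λ δ →
    (∀ c d → proj₁ (δ (DihedralMul (suc q′) c d)) ≡ matMul F (proj₁ (δ c)) (proj₁ (δ d))) ×
    (∀ c d → proj₁ (δ c) ≡ proj₁ (δ d) → c ≡ d) ×
    (∀ c → act (δ c) x ≡ x) ×
    (∀ A → act A x ≡ x → ∃ λ c → proj₁ (δ c) ≡ proj₁ A))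
  where
  open Characteristic2 F 1+1≡0

  q : ℕ
  q = suc q′

  record Involution : Set where
    constructor involution
    field
      element : SL
      trace-0 : tr (proj₁ element) ≡ 0#
      ≢I      : proj₁ element ≢ I
    matrix : Mat
    matrix = proj₁ element
    det-1 : Det matrix ≡ 1#
    det-1 = proj₂ element
    square : matrix ⊗ matrix ≡ I
    square = tr≡0⇒involution matrix det-1 trace-0
  open Involution

  act-cong : ∀ A B → proj₁ A ≡ proj₁ B → ∀ x → act A x ≡ act B x
  act-cong A B A≡B x = trans (act-⊗ B 1ₛ A (trans A≡B (sym (⊗-identityʳ _))) x) (cong (act B) (act-1 1ₛ refl x))

  act-⊙ : ∀ A B x → act (A ⊙ B) x ≡ act A (act B x)
  act-⊙ A B = act-⊗ A B (A ⊙ B) refl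

  act-inverse : ∀ A x → act (A ⁻¹ₛ) (act A x) ≡ x
  act-inverse A x = trans (sym (act-⊙ (A ⁻¹ₛ) A x)) (act-1 _ (adj-inverse (proj₁ A) (proj₂ A)) x)

  act-commute : ∀ A B → proj₁ A ⊗ proj₁ B ≡ proj₁ B ⊗ proj₁ A → ∀ x → act A (act B x) ≡ act B (act A x)
  act-commute A B comm x = trans (sym (act-⊙ A B x)) (trans (act-cong (A ⊙ B) (B ⊙ A) comm x) (act-⊙ B A x))

  commuting-fixers-equal : ∀ x (X Y : Involution) → act (element X) x ≡ x → act (element Y) x ≡ x →
    matrix X ⊗ matrix Y ≡ matrix Y ⊗ matrix X → matrix X ≡ matrix Y
  commuting-fixers-equal x X Y Xx≡x Yx≡x comm with stabilizer x
  ... | δ , δ-hom , δ-inj , _ , complete =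
    Dihedral.commuting-involutions-equal k k*2≡q δ δ-hom δ-inj (matrix X) (matrix Y)
      (complete (element X) Xx≡x) (complete (element Y) Yx≡x) (square X) (square Y) (≢I X) (≢I Y) comm

  fixers-conjugate : ∀ x (X Y : Involution) → act (element X) x ≡ x → act (element Y) x ≡ x →
    ∃ λ s → act s x ≡ x × proj₁ s ⊗ matrix X ≡ matrix Y ⊗ proj₁ s
  fixers-conjugate x X Y Xx≡x Yx≡x with stabilizer x
  ... | δ , δ-hom , δ-inj , fixes , complete =
    let c , eq = Dihedral.involutions-conjugate k k*2≡q δ δ-hom δ-inj (matrix X) (matrix Y)
          (complete (element X) Xx≡x) (complete (element Y) Yx≡x) (square X) (square Y) (≢I X) (≢I Y)
    in δ c , fixes c , eq

  fixers-span : ∀ x → ∃ λ A → tr A ≢ 0# ×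
    (∀ M → M ⟂ A → M ≢ 0M → ∃₂ λ l τ → act (element τ) x ≡ x × M ≡ l • matrix τ)
  fixers-span x with stabilizer x
  ... | δ , δ-hom , δ-inj , fixes , _ =
    let A , trA≢0 , span = Dihedral.reflections-span k k*2≡q δ δ-hom δ-inj
    in A , trA≢0 , λ M M⟂A M≢0 →
      let l , c , tr≡0 , ≢I , M≡ = span M M⟂A M≢0
      in l , involution (δ c) tr≡0 ≢I , fixes c , M≡

  det≡1⇒≢0M : ∀ M → Det M ≡ 1# → M ≢ 0M
  det≡1⇒≢0M M detM M≡0 = 0≢1 (trans (sym det-0M) (trans (cong Det (sym M≡0)) detM))

  -- Two planes of matrices ⟂ to A and ⟂ to A' meet in a line of the three-dimensional space
  -- of matrices of trace 0.
  planes-meet : ∀ A A' → tr A ≢ 0# → ∃ λ M → M ≢ 0M × M ⟂ A × M ⟂ A'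
  planes-meet A@(mat a b c d) A'@(mat a' b' c' d') e≢0 = by-cases (p ≟ 0#)
    where
    open ≡-Reasoning
    e = a + d
    e' = a' + d'
    p = (c * e') + (c' * e)
    r = (b * e') + (b' * e)
    -- Eliminating the diagonal entry by means of the first plane turns the second condition into x
    -- p + y r = 0. One linear equation in two unknowns has a nonzero solution: (1, 0) if p = 0, and
    -- (r, p) otherwise.
    meet : ∀ x y → ¬ (x ≡ 0# × y ≡ 0#) → (x * p) + (y * r) ≡ 0# → ∃ λ M → M ≢ 0M × M ⟂ A × M ⟂ A'
    meet x y xy≢0 eq = M , (λ M≡0 → xy≢0 (cong Mat2.b M≡0 , cong Mat2.c M≡0)) ,
      (x+x≡0 m , (begin
        tr (M ⊗ A)            ≡⟨ tr-⊗ m x y a b c d ⟩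
        (m * e) + w           ≡⟨ cong (_+ w) (*-recip-cancel w e e≢0) ⟩
        w + w                 ≡⟨ x+x≡0 w ⟩
        0#                    ∎)) ,
      (x+x≡0 m , *-zero⇒zero e _ e≢0 (begin
        e * tr (M ⊗ A')                               ≡⟨ cong (e *_) (tr-⊗ m x y a' b' c' d') ⟩
        e * ((m * e') + ((x * c') + (y * b')))        ≡⟨ solve 7 (λ e m e' x y c' b' → e :* ((m :* e') :+ ((x :* c') :+ (y :* b'))) := ((m :* e) :* e') :+ (((x :* c') :+ (y :* b')) :* e)) refl e m e' x y c' b' ⟩
        ((m * e) * e') + (((x * c') + (y * b')) * e)  ≡⟨ cong (λ z → (z * e') + (((x * c') + (y * b')) * e)) (*-recip-cancel w e e≢0) ⟩
        (w * e') + (((x * c') + (y * b')) * e)        ≡⟨ solve 8 (λ x y b c b' c' e e' → (((x :* c) :+ (y :* b)) :* e') :+ (((x :* c') :+ (y :* b')) :* e) := (x :* ((c :* e') :+ (c' :* e))) :+ (y :* ((b :* e') :+ (b' :* e)))) refl x y b c b' c' e e' ⟩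
        (x * p) + (y * r)                             ≡⟨ eq ⟩
        0#                                            ∎))
      where
      w = (x * c) + (y * b)
      m = w * recip e
      M = mat m x y m
    by-cases : Dec (p ≡ 0#) → ∃ λ M → M ≢ 0M × M ⟂ A × M ⟂ A'
    by-cases (yes p≡0) = meet 1# 0# (λ { (1≡0 , _) → 0≢1 (sym 1≡0) })
      (trans (cong (λ z → (1# * z) + (0# * r)) p≡0) (solve 1 (λ r → (con true :* con false) :+ (con false :* r) := con false) refl r))
    by-cases (no p≢0) = meet r p (λ { (_ , p≡0) → p≢0 p≡0 })
      (trans (cong (_+ (p * r)) (*-comm r p)) (x+x≡0 _))

  -- A nonzero matrix in both planes is a multiple of an involution fixing `x` and of one fixing
  -- `y`; being proportional, the two are equal.
  common-fixer : ∀ x y → ∃ λ τ → act (element τ) x ≡ x × act (element τ) y ≡ y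
  common-fixer x y =
    let A , trA≢0 , span = fixers-span x
        A' , _ , span' = fixers-span y
        M , M≢0 , M⟂A , M⟂A' = planes-meet A A' trA≢0
        l , τ , τx≡x , M≡lτ = span M M⟂A M≢0
        l' , τ' , τ'y≡y , M≡l'τ' = span' M M⟂A' M≢0
        l≢0 = λ l≡0 → M≢0 (trans M≡lτ (trans (cong (_• matrix τ) l≡0) (0•A _)))
        τ≡τ' = scalar-in-SL (recip l * l') (matrix τ) (matrix τ') (det-1 τ) (det-1 τ')
                 (•-divide l l' (matrix τ) (matrix τ') l≢0 (trans (sym M≡lτ) M≡l'τ'))
    in τ , τx≡x , trans (act-cong (element τ) (element τ') τ≡τ' y) τ'y≡y
    where
    •-divide : ∀ l l' A B → l ≢ 0# → l • A ≡ l' • B → A ≡ (recip l * l') • B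
    •-divide l l' (mat a b c d) (mat a' b' c' d') l≢0 eq = mat-cong
      (divide a a' (cong Mat2.a eq)) (divide b b' (cong Mat2.b eq)) (divide c c' (cong Mat2.c eq)) (divide d d' (cong Mat2.d eq))
      where
      open ≡-Reasoning
      divide : ∀ a a' → l * a ≡ l' * a' → a ≡ (recip l * l') * a'
      divide a a' eq = begin
        a                     ≡⟨ *-recip-cancel a l l≢0 ⟨
        (a * recip l) * l     ≡⟨ solve 3 (λ a r l → (a :* r) :* l := r :* (l :* a)) refl a (recip l) l ⟩
        recip l * (l * a)     ≡⟨ cong (recip l *_) eq ⟩
        recip l * (l' * a')   ≡⟨ *-assoc _ _ _ ⟨
        (recip l * l') * a'   ∎

  pencilₛ : Involution → Fin q → SL
  pencilₛ u t = pencil (matrix u) t , det-pencil (matrix u) t (det-1 u) (trace-0 u)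

  pencil-involution : Involution → (t : Fin q) → t ≢ 0# → Involution
  pencil-involution u t t≢0 = involution (pencilₛ u t) (tr-pencil (matrix u) t (trace-0 u))
    (λ eq → ≢I u (pencil≡I (matrix u) t t≢0 eq))

  act-pencil-+ : ∀ u s t x → act (pencilₛ u (s + t)) x ≡ act (pencilₛ u s) (act (pencilₛ u t) x)
  act-pencil-+ u s t = act-⊗ _ _ _ (sym (pencil-+ (matrix u) s t (trace-0 u) (det-1 u)))

  act-pencil-0 : ∀ u t → t ≡ 0# → ∀ x → act (pencilₛ u t) x ≡ x
  act-pencil-0 u t refl x = act-1 _ (pencil-0 (matrix u)) x

  -- On the pencil, tr (M A) is affine in the parameter, with constant term tr A and slope tr (N A)
  -- for N = u + I. Its root is the required parameter, nonzero because tr A is.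
  pencil-fixer : ∀ u x → ∃ λ t → t ≢ 0# × act (pencilₛ u t) x ≡ x
  pencil-fixer u x = t , t≢0 , trans (act-cong (pencilₛ u t) (element τ) M≡τ x) τx≡x
    where
    open ≡-Reasoning
    A : Mat
    A = proj₁ (fixers-span x)
    trA≢0 : tr A ≢ 0#
    trA≢0 = proj₁ (proj₂ (fixers-span x))
    span = proj₂ (proj₂ (fixers-span x))
    N : Mat
    N = nilpotent (matrix u)
    N≢0 : N ≢ 0M
    N≢0 N≡0 = ≢I u (nilpotent≡0⇒≡I (matrix u) N≡0)
    g = tr (N ⊗ A)
    -- Were the slope 0, `N` would lie in the plane of `x` and be a nonzero multiple of an
    -- involution, although its determinant is 0.
    g≢0 : g ≢ 0#
    g≢0 g≡0 = N≢0 (trans N≡lτ (trans (cong (_• matrix τ) l≡0) (0•A _)))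
      where
      spanN = span N (trans (tr-nilpotent (matrix u)) (trace-0 u) , g≡0) N≢0
      l = proj₁ spanN
      τ = proj₁ (proj₂ spanN)
      N≡lτ : N ≡ l • matrix τ
      N≡lτ = proj₂ (proj₂ (proj₂ spanN))
      l≡0 : l ≡ 0#
      l≡0 = x*x≡0⇒x≡0 l (begin
        l * l                      ≡⟨ *-identityʳ _ ⟨
        (l * l) * 1#               ≡⟨ cong ((l * l) *_) (det-1 τ) ⟨
        (l * l) * Det (matrix τ)   ≡⟨ det-• l (matrix τ) ⟨
        Det (l • matrix τ)         ≡⟨ cong Det N≡lτ ⟨
        Det N                      ≡⟨ det-nilpotent (matrix u) (det-1 u) (trace-0 u) ⟩
        0#                         ∎)
    t = tr A * recip g
    t≢0 : t ≢ 0#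
    t≢0 t≡0 = trA≢0 (trans (sym (*-recip-cancel (tr A) g g≢0)) (trans (cong (_* g) t≡0) (zeroˡ g)))
    M : Mat
    M = pencil (matrix u) t
    M⟂A : M ⟂ A
    M⟂A = tr-pencil (matrix u) t (trace-0 u) , (begin
      tr (M ⊗ A)         ≡⟨ tr-pencil-⊗ (matrix u) t A ⟩
      tr A + (t * g)     ≡⟨ cong (tr A +_) (*-recip-cancel (tr A) g g≢0) ⟩
      tr A + tr A        ≡⟨ x+x≡0 (tr A) ⟩
      0#                 ∎)
    detM : Det M ≡ 1#
    detM = proj₂ (pencilₛ u t)
    spanM = span M M⟂A (det≡1⇒≢0M M detM)
    τ = proj₁ (proj₂ spanM)
    τx≡x : act (element τ) x ≡ x
    τx≡x = proj₁ (proj₂ (proj₂ spanM))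
    M≡τ : M ≡ matrix τ
    M≡τ = scalar-in-SL (proj₁ spanM) M (matrix τ) detM (det-1 τ) (proj₂ (proj₂ (proj₂ spanM)))

  -- Members of a pencil commute, so two involutions among them fixing `x` agree; their product has
  -- parameter `s + t` and is I, which forces that parameter to be 0.
  pencil-fixer-unique : ∀ u x s t → s ≢ 0# → t ≢ 0# →
    act (pencilₛ u s) x ≡ x → act (pencilₛ u t) x ≡ x → s ≡ t
  pencil-fixer-unique u x s t s≢0 t≢0 sx≡x tx≡x with (s + t) ≟ 0#
  ... | yes s+t≡0 = x+y≡0⇒x≡y s t s+t≡0
  ... | no  s+t≢0 = contradiction (pencil≡I (matrix u) (s + t) s+t≢0 (begin
    pencil (matrix u) (s + t)                       ≡⟨ pencil-+ (matrix u) s t (trace-0 u) (det-1 u) ⟨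
    pencil (matrix u) s ⊗ pencil (matrix u) t       ≡⟨ cong (_⊗ pencil (matrix u) t) equal ⟩
    pencil (matrix u) t ⊗ pencil (matrix u) t       ≡⟨ square (pencil-involution u t t≢0) ⟩
    I                                               ∎)) (≢I u)
    where
    open ≡-Reasoning
    equal : pencil (matrix u) s ≡ pencil (matrix u) t
    equal = commuting-fixers-equal x (pencil-involution u s s≢0) (pencil-involution u t t≢0) sx≡x tx≡x
      (trans (pencil-+ (matrix u) s t (trace-0 u) (det-1 u)) (trans (cong (pencil (matrix u)) (+-comm s t))
        (sym (pencil-+ (matrix u) t s (trace-0 u) (det-1 u)))))

  -- Transitivity, from the Borel subgroup formed by the pencil of `shear` (the upper unitriangular
  -- matrices) and the diagonal matrices.

  shear : Involution
  shear = involution (mat 1# 1# 0# 1# , det-shear) 1+1≡0 (λ eq → 0≢1 (sym (cong Mat2.b eq)))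
    where
    abstract
      det-shear : Det (mat 1# 1# 0# 1#) ≡ 1#
      det-shear = solve 0 ((con true :* con true) :+ (:- (con true :* con false)) := con true) refl

  diagonal : (c : Fin q) → c ≢ 0# → SL
  diagonal c c≢0 = mat c 0# 0# (recip c) , det-diagonal
    where
    abstract
      det-diagonal : Det (mat c 0# 0# (recip c)) ≡ 1#
      det-diagonal = trans (solve 2 (λ c r → (c :* r) :+ (:- (con false :* con false)) := c :* r) refl c (recip c)) (recip-inverse c c≢0)

  -- The torus normalizes the unitriangular group and acts on its parameter by c². As squaring is
  -- injective, this distinguishes the orbits starting at different `base c`.
  diagonal-shear : ∀ c c≢0 s → proj₁ (diagonal c c≢0) ⊗ pencil (matrix shear) s
                             ≡ pencil (matrix shear) ((c * c) * s) ⊗ proj₁ (diagonal c c≢0)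
  diagonal-shear c c≢0 s = mat-cong
    (solve 3 (λ c r s → (c :* (con true :+ (s :* (con true :+ con true)))) :+ (con false :* (s :* con false))
       := ((con true :+ (((c :* c) :* s) :* (con true :+ con true))) :* c) :+ ((((c :* c) :* s) :* con true) :* con false)) refl c (recip c) s)
    (trans (solve 3 (λ c r s → (c :* (s :* con true)) :+ (con false :* (con true :+ (s :* (con true :+ con true)))) := (c :* s) :* con true) refl c (recip c) s)
      (trans (cong ((c * s) *_) (sym (recip-inverse c c≢0)))
      (solve 3 (λ c r s → (c :* s) :* (c :* r) := ((con true :+ (((c :* c) :* s) :* (con true :+ con true))) :* con false) :+ ((((c :* c) :* s) :* con true) :* r)) refl c (recip c) s)))
    (solve 3 (λ c r s → (con false :* (con true :+ (s :* (con true :+ con true)))) :+ (r :* (s :* con false))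
       := ((((c :* c) :* s) :* con false) :* c) :+ ((con true :+ (((c :* c) :* s) :* (con true :+ con true))) :* con false)) refl c (recip c) s)
    (solve 3 (λ c r s → (con false :* (s :* con true)) :+ (r :* (con true :+ (s :* (con true :+ con true))))
       := ((((c :* c) :* s) :* con false) :* con false) :+ ((con true :+ (((c :* c) :* s) :* (con true :+ con true))) :* r)) refl c (recip c) s)

  *-nonzero : ∀ x y → x ≢ 0# → y ≢ 0# → x * y ≢ 0#
  *-nonzero x y x≢0 y≢0 xy≡0 = y≢0 (*-zero⇒zero x y x≢0 xy≡0)

  -- Each point has exactly two preimages under the orbit map of the Borel subgroup of order
  -- q (q - 1) = 2 v; ordering them embeds that subgroup into (points × 2), which is then onto.
  module BorelOrbit (x : Fin v) (s : Fin q) (s≢0 : s ≢ 0#) (sx≡x : act (pencilₛ shear s) x ≡ x) where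
    open ≡-Reasoning
    U : Fin q → SL
    U = pencilₛ shear
    scale : Fin q′ → Fin q
    scale = punchIn 0#
    scale≢0 : ∀ c → scale c ≢ 0#
    scale≢0 = Fin.punchInᵢ≢i 0#
    D : Fin q′ → SL
    D c = diagonal (scale c) (scale≢0 c)
    -- The parameter of the one unitriangular involution that fixes `base c`, and with it every
    -- point of `orbit c`.
    shift : Fin q′ → Fin q
    shift c = (scale c * scale c) * s
    shift≢0 : ∀ c → shift c ≢ 0#
    shift≢0 c = *-nonzero (scale c * scale c) s (*-nonzero (scale c) (scale c) (scale≢0 c) (scale≢0 c)) s≢0
    base : Fin q′ → Fin v
    base c = act (D c) x
    base-fixed : ∀ c → act (U (shift c)) (base c) ≡ base c
    base-fixed c = begin
      act (U (shift c)) (act (D c) x)   ≡⟨ act-⊙ (U (shift c)) (D c) x ⟨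
      act (U (shift c) ⊙ D c) x         ≡⟨ act-⊗ (D c) (U s) _ (sym (diagonal-shear (scale c) (scale≢0 c) s)) x ⟩
      act (D c) (act (U s) x)           ≡⟨ cong (act (D c)) sx≡x ⟩
      act (D c) x                       ∎
    orbit : Fin q′ → Fin q → Fin v
    orbit c t = act (U t) (base c)
    orbit-fixed : ∀ c t → act (U (shift c)) (orbit c t) ≡ orbit c t
    orbit-fixed c t = begin
      act (U (shift c)) (act (U t) (base c))   ≡⟨ act-pencil-+ shear (shift c) t (base c) ⟨
      act (U (shift c + t)) (base c)           ≡⟨ cong (λ z → act (U z) (base c)) (+-comm (shift c) t) ⟩
      act (U (t + shift c)) (base c)           ≡⟨ act-pencil-+ shear t (shift c) (base c) ⟩
      act (U t) (act (U (shift c)) (base c))   ≡⟨ cong (act (U t)) (base-fixed c) ⟩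
      act (U t) (base c)                       ∎
    -- A point determines the nonzero parameter that fixes it, so equal points have equal shifts,
    -- and c can be recovered from c² s.
    orbit-injective₁ : ∀ c c' t t' → orbit c t ≡ orbit c' t' → c ≡ c'
    orbit-injective₁ c c' t t' eq = Fin.punchIn-injective 0# c c' (square-injective (scale c) (scale c') (*-cancelˡ s _ _ s≢0
      (trans (*-comm s (scale c * scale c)) (trans shifts≡ (*-comm (scale c' * scale c') s)))))
      where
      shifts≡ : shift c ≡ shift c'
      shifts≡ = pencil-fixer-unique shear (orbit c t) (shift c) (shift c') (shift≢0 c) (shift≢0 c') (orbit-fixed c t)
        (subst (λ z → act (U (shift c')) z ≡ z) (sym eq) (orbit-fixed c' t'))
    -- Equal images mean that `U (t + t')` fixes `base c`; so t + t' is either 0 or the unique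
    -- fixing parameter.
    orbit-fibre : ∀ c t t' → orbit c t ≡ orbit c t' → t ≡ t' ⊎ t' ≡ t + shift c
    orbit-fibre c t t' eq with (t + t') ≟ 0#
    ... | yes t+t'≡0 = inj₁ (x+y≡0⇒x≡y t t' t+t'≡0)
    ... | no  t+t'≢0 = inj₂ (begin
      t'               ≡⟨ solve 2 (λ t t' → t' := t :+ (t :+ t')) refl t t' ⟩
      t + (t + t')     ≡⟨ cong (t +_) (pencil-fixer-unique shear (base c) (t + t') (shift c) t+t'≢0 (shift≢0 c) fixed (base-fixed c)) ⟩
      t + shift c      ∎)
      where
      fixed : act (U (t + t')) (base c) ≡ base c
      fixed = begin
        act (U (t + t')) (base c)            ≡⟨ act-pencil-+ shear t t' (base c) ⟩
        act (U t) (act (U t') (base c))      ≡⟨ cong (act (U t)) eq ⟨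
        act (U t) (act (U t) (base c))       ≡⟨ act-pencil-+ shear t t (base c) ⟨
        act (U (t + t)) (base c)             ≡⟨ act-pencil-0 shear (t + t) (x+x≡0 t) (base c) ⟩
        base c                               ∎
    label : Fin q′ → Fin q → Fin (v ℕ.* 2)
    label c t = combine (orbit c t) (side t (t + shift c))
    label-injective : ∀ c t c' t' → label c t ≡ label c' t' → c ≡ c' × t ≡ t'
    label-injective c t c' t' eq = same-point c' t' (proj₁ parts) (orbit-injective₁ c c' t t' (proj₁ parts)) (proj₂ parts)
      where
      parts : orbit c t ≡ orbit c' t' × side t (t + shift c) ≡ side t' (t' + shift c')
      parts = Fin.combine-injective (orbit c t) (side t (t + shift c)) (orbit c' t') (side t' (t' + shift c')) eq
      -- Replacing t by t + `shift c` swaps the arguments of `side`, so equal labels leave only the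
      -- case of equal parameters.
      same-fibre : ∀ t' → side t (t + shift c) ≡ side t' (t' + shift c) → t ≡ t' ⊎ t' ≡ t + shift c → t ≡ t'
      same-fibre t' side≡ (inj₁ t≡t') = t≡t'
      same-fibre t' side≡ (inj₂ refl) = side-symmetric⇒≡ t (t + shift c) (trans side≡ (cong (side (t + shift c))
        (solve 2 (λ t s → (t :+ s) :+ s := t) refl t (shift c))))
      same-point : ∀ c' t' → orbit c t ≡ orbit c' t' → c ≡ c' →
        side t (t + shift c) ≡ side t' (t' + shift c') → c ≡ c' × t ≡ t'
      same-point c' t' orbit≡ refl side≡ = refl , same-fibre t' side≡ (orbit-fibre c t t' orbit≡)
    label′ : Fin (q ℕ.* q′) → Fin (v ℕ.* 2)
    label′ i = label (proj₂ (remQuot {q} q′ i)) (proj₁ (remQuot {q} q′ i))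
    label′-injective : Injective _≡_ _≡_ label′
    label′-injective {i} {j} eq = trans (sym (Fin.combine-remQuot {q} q′ i))
      (trans (cong₂ combine (proj₂ parts) (proj₁ parts)) (Fin.combine-remQuot {q} q′ j))
      where
      parts = label-injective (proj₂ (remQuot {q} q′ i)) (proj₁ (remQuot {q} q′ i)) (proj₂ (remQuot {q} q′ j)) (proj₁ (remQuot {q} q′ j)) eq
    onto : ∀ y → ∃₂ λ c t → orbit c t ≡ y
    onto y = c , t , Fin.combine-injectiveˡ (orbit c t) (side t (t + shift c)) y zero (proj₂ hit)
      where
      hit : ∃ λ i → label′ i ≡ combine y zero
      hit = injective⇒surjective {q ℕ.* q′} {v ℕ.* 2} (sym v*2≡q[q-1]) label′ label′-injective (combine y zero)
      c = proj₂ (remQuot {q} q′ (proj₁ hit))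
      t = proj₁ (remQuot {q} q′ (proj₁ hit))

  transitive : ∀ x y → ∃ λ g → act g x ≡ y
  transitive x y = U t ⊙ D c , trans (act-⊙ (U t) (D c) x) (proj₂ (proj₂ (onto y)))
    where
    open BorelOrbit x (proj₁ (pencil-fixer shear x)) (proj₁ (proj₂ (pencil-fixer shear x))) (proj₂ (proj₂ (pencil-fixer shear x)))
    c = proj₁ (onto y)
    t = proj₁ (proj₂ (onto y))

  -- If g x = y then u and g⁻¹ u g are both involutions fixing x, hence conjugate in the stabilizer of x.
  fixed-points-in-orbit : ∀ u x y → act (element u) x ≡ x → act (element u) y ≡ y →
    ∃ λ t → act (pencilₛ u t) x ≡ y
  fixed-points-in-orbit u x y ux≡x uy≡y = proj₁ on-pencil ,
    trans (act-cong (pencilₛ u (proj₁ on-pencil)) h (sym (proj₂ on-pencil)) x)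
      (trans (act-⊙ g s x) (trans (cong (act g) sx≡x) gx≡y))
    where
    g : SL
    g = proj₁ (transitive x y)
    gx≡y : act g x ≡ y
    gx≡y = proj₂ (transitive x y)
    Y : SL
    Y = (g ⁻¹ₛ) ⊙ (element u ⊙ g)
    trY : tr (proj₁ Y) ≡ 0#
    trY = trans (tr-conjugate (proj₁ g) (matrix u)) (trans (cong (Det (proj₁ g) *_) (trace-0 u)) (zeroʳ (Det (proj₁ g))))
    Y≢I : proj₁ Y ≢ I
    Y≢I Y≡I = ≢I u (conjugate≡I g (matrix u) Y≡I)
    Yx≡x : act Y x ≡ x
    Yx≡x = trans (act-⊙ (g ⁻¹ₛ) (element u ⊙ g) x) (trans (cong (act (g ⁻¹ₛ)) (trans (act-⊙ (element u) g x)
      (trans (cong (act (element u)) gx≡y) (trans uy≡y (sym gx≡y))))) (act-inverse g x))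
    conjugate : ∃ λ s → act s x ≡ x × proj₁ s ⊗ matrix u ≡ proj₁ Y ⊗ proj₁ s
    conjugate = fixers-conjugate x u (involution Y trY Y≢I) ux≡x Yx≡x
    s : SL
    s = proj₁ conjugate
    sx≡x : act s x ≡ x
    sx≡x = proj₁ (proj₂ conjugate)
    h : SL
    h = g ⊙ s
    on-pencil : ∃ λ t → proj₁ h ≡ pencil (matrix u) t
    on-pencil = centralizer⊆pencil (matrix u) (proj₁ h) (det-1 u) (trace-0 u) (≢I u) (proj₂ h)
      (conjugator-commutes g s (matrix u) (proj₂ (proj₂ conjugate)))

  -- Taking `h` in the pencil of `τ` gives h² = 1, so an `h` that sends `x` to `y` also sends `y`
  -- back to `x`.
  pair-stabilizer : ∀ x y → ∃₂ λ τ h → act (element τ) x ≡ x × act (element τ) y ≡ y ×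
    act h x ≡ y × act h y ≡ x
  pair-stabilizer x y = τ , pencilₛ τ t , τx≡x , τy≡y , hx≡y , (begin
    act (pencilₛ τ t) y                       ≡⟨ cong (act (pencilₛ τ t)) hx≡y ⟨
    act (pencilₛ τ t) (act (pencilₛ τ t) x)   ≡⟨ act-pencil-+ τ t t x ⟨
    act (pencilₛ τ (t + t)) x                 ≡⟨ act-pencil-0 τ (t + t) (x+x≡0 t) x ⟩
    x                                         ∎)
    where
    open ≡-Reasoning
    τ = proj₁ (common-fixer x y)
    τx≡x = proj₁ (proj₂ (common-fixer x y))
    τy≡y = proj₂ (proj₂ (common-fixer x y))
    t = proj₁ (fixed-points-in-orbit τ x y τx≡x τy≡y)
    hx≡y = proj₂ (fixed-points-in-orbit τ x y τx≡x τy≡y)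

  -- Fixed points of involutions, and the bound on the number of blocks they can support.

  Fix : Involution → Subset v
  Fix u = tabulate (λ x → does (act (element u) x ≟ x))

  fixed⇒∈Fix : ∀ u x → act (element u) x ≡ x → x ∈ Fix u
  fixed⇒∈Fix u x ux≡x = lookup⇒[]= x (Fix u) (trans (lookup∘tabulate _ x) (dec-true (act (element u) x ≟ x) ux≡x))

  ∈Fix⇒fixed : ∀ u x → x ∈ Fix u → act (element u) x ≡ x
  ∈Fix⇒fixed u x x∈ with act (element u) x ≟ x | trans (sym (lookup∘tabulate (λ x → does (act (element u) x ≟ x)) x)) ([]=⇒lookup x∈)
  ... | yes ux≡x | _ = ux≡x

  -- The centralizer of u has q elements and acts transitively on Fix u, with u acting trivially.
  ∣Fix∣≤k : ∀ u x → x ∈ Fix u → ∣ Fix u ∣ ℕ.≤ k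
  ∣Fix∣≤k u x x∈Fix = ℕ.*-cancelʳ-≤ ∣ Fix u ∣ k 2 (subst (∣ Fix u ∣ ℕ.* 2 ℕ.≤_) (sym k*2≡q)
    (Fin.injective⇒≤ {f = preimage′} preimage′-injective))
    where
    open ≡-Reasoning
    S = Fix u
    e = proj₁ (enumerate S)
    e∈ = proj₁ (proj₂ (enumerate S))
    e-injective = proj₂ (proj₂ (enumerate S))
    ux≡x = ∈Fix⇒fixed u x x∈Fix
    mover : ∀ j → ∃ λ t → act (pencilₛ u t) x ≡ e j
    mover j = fixed-points-in-orbit u x (e j) ux≡x (∈Fix⇒fixed u (e j) (e∈ j))
    -- The parameters of I and of `u`, both of which fix `x`; adding them to a parameter moving `x`
    -- to a point gives two such parameters.
    bit : Fin 2 → Fin q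
    bit zero       = 0#
    bit (suc zero) = 1#
    bit-injective : ∀ b b' → bit b ≡ bit b' → b ≡ b'
    bit-injective zero       zero       _  = refl
    bit-injective zero       (suc zero) eq = contradiction eq 0≢1
    bit-injective (suc zero) zero       eq = contradiction (sym eq) 0≢1
    bit-injective (suc zero) (suc zero) _  = refl
    bit-fixes : ∀ b → act (pencilₛ u (bit b)) x ≡ x
    bit-fixes zero       = act-pencil-0 u 0# refl x
    bit-fixes (suc zero) = trans (act-cong (pencilₛ u 1#) (element u) (pencil-1 (matrix u)) x) ux≡x
    preimage : Fin ∣ S ∣ → Fin 2 → Fin q
    preimage j b = proj₁ (mover j) + bit b
    act-preimage : ∀ j b → act (pencilₛ u (preimage j b)) x ≡ e j
    act-preimage j b = trans (act-pencil-+ u (proj₁ (mover j)) (bit b) x)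
      (trans (cong (act (pencilₛ u (proj₁ (mover j)))) (bit-fixes b)) (proj₂ (mover j)))
    preimage-injective : ∀ j b j' b' → preimage j b ≡ preimage j' b' → j ≡ j' × b ≡ b'
    preimage-injective j b j' b' eq = same-point j' eq (e-injective (begin
        e j                                  ≡⟨ act-preimage j b ⟨
        act (pencilₛ u (preimage j b)) x     ≡⟨ cong (λ z → act (pencilₛ u z) x) eq ⟩
        act (pencilₛ u (preimage j' b')) x   ≡⟨ act-preimage j' b' ⟩
        e j'                                 ∎))
      where
      same-point : ∀ j' → preimage j b ≡ preimage j' b' → j ≡ j' → j ≡ j' × b ≡ b'
      same-point j' eq refl = refl , bit-injective b b' (+-cancelˡ (proj₁ (mover j)) (bit b) (bit b') eq)
    preimage′ : Fin (∣ S ∣ ℕ.* 2) → Fin q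
    preimage′ i = preimage (proj₁ (remQuot {∣ S ∣} 2 i)) (proj₂ (remQuot {∣ S ∣} 2 i))
    preimage′-injective : Injective _≡_ _≡_ preimage′
    preimage′-injective {i} {i'} eq = trans (sym (Fin.combine-remQuot {∣ S ∣} 2 i))
      (trans (cong₂ combine (proj₁ parts) (proj₂ parts)) (Fin.combine-remQuot {∣ S ∣} 2 i'))
      where
      parts = preimage-injective (proj₁ (remQuot {∣ S ∣} 2 i)) (proj₂ (remQuot {∣ S ∣} 2 i))
        (proj₁ (remQuot {∣ S ∣} 2 i')) (proj₂ (remQuot {∣ S ∣} 2 i')) eq

  pencil-fixes-image : ∀ u X t x → proj₁ X ⊗ matrix u ≡ matrix u ⊗ proj₁ X →
    act (pencilₛ u t) x ≡ x → act (pencilₛ u t) (act X x) ≡ act X x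
  pencil-fixes-image u X t x comm tx≡x =
    trans (sym (act-commute X (pencilₛ u t) (pencil-commutes (proj₁ X) (matrix u) t comm) x)) (cong (act X) tx≡x)

  -- Commuting with `u`, `τ` commutes with its whole pencil; the pencil member fixing `x` is
  -- therefore `τ` itself, which also fixes `y`.
  pencil-fixes-common : ∀ u τ t x y → t ≢ 0# → matrix τ ⊗ matrix u ≡ matrix u ⊗ matrix τ →
    act (element τ) x ≡ x → act (element τ) y ≡ y → act (pencilₛ u t) x ≡ x → act (pencilₛ u t) y ≡ y
  pencil-fixes-common u τ t x y t≢0 comm τx≡x τy≡y tx≡x =
    trans (act-cong (pencilₛ u t) (element τ) (sym τ≡pencil) y) τy≡y
    where
    τ≡pencil : matrix τ ≡ pencil (matrix u) t
    τ≡pencil = commuting-fixers-equal x τ (pencil-involution u t t≢0) τx≡x tx≡x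
      (pencil-commutes (matrix τ) (matrix u) t comm)

  Fix-cong : ∀ u w → matrix u ≡ matrix w → Fix u ≡ Fix w
  Fix-cong u w u≡w = tabulate-cong (λ x → cong (λ z → does (z ≟ x)) (act-cong (element u) (element w) u≡w x))

  -- An involution is determined by its two off-diagonal entries.
  too-many-blocks : ∀ {b} (B : Fin b → Subset v) → (∀ i j → B i ≡ B j → i ≡ j) → (∀ i → ∣ B i ∣ ≡ k) →
    0 ℕ.< k → q ℕ.* q ℕ.< b → ¬ (∀ j → ∃ λ u → ∀ x → x ∈ B j → act (element u) x ≡ x)
  too-many-blocks {b} B B-injective ∣B∣≡k 0<k qq<b fixer = ℕ.<⇒≢ i<j (cong toℕ (B-injective i j
    (trans (B≡Fix i) (trans (Fix-cong (u i) (u j) u≡) (sym (B≡Fix j))))))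
    where
    u : Fin b → Involution
    u i = proj₁ (fixer i)
    -- The block has k points and `Fix` at most k, so inclusion is equality. A point of the block
    -- serves as the fixed point required by the bound.
    B≡Fix : ∀ i → B i ≡ Fix (u i)
    B≡Fix i = ⊆∧∣∣≥⇒≡ B⊆Fix (subst (∣ Fix (u i) ∣ ℕ.≤_) (sym (∣B∣≡k i))
      (∣Fix∣≤k (u i) (proj₁ point) (B⊆Fix (proj₂ point))))
      where
      B⊆Fix : B i ⊆ Fix (u i)
      B⊆Fix {x} x∈ = fixed⇒∈Fix (u i) x (proj₂ (fixer i) x x∈)
      point : ∃ λ x → x ∈ B i
      point = ∣∣>0⇒nonempty (B i) (subst (0 ℕ.<_) (sym (∣B∣≡k i)) 0<k)
    corner₁ corner₂ : Fin b → Fin q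
    corner₁ i = Mat2.b (matrix (u i))
    corner₂ i = Mat2.c (matrix (u i))
    code : Fin b → Fin (q ℕ.* q)
    code i = combine (corner₁ i) (corner₂ i)
    collision : ∃₂ λ i j → toℕ i ℕ.< toℕ j × code i ≡ code j
    collision = Fin.pigeonhole qq<b code
    i j : Fin b
    i = proj₁ collision
    j = proj₁ (proj₂ collision)
    i<j : toℕ i ℕ.< toℕ j
    i<j = proj₁ (proj₂ (proj₂ collision))
    corners≡ : corner₁ i ≡ corner₁ j × corner₂ i ≡ corner₂ j
    corners≡ = Fin.combine-injective (corner₁ i) (corner₂ i) (corner₁ j) (corner₂ j) (proj₂ (proj₂ (proj₂ collision)))
    u≡ : matrix (u i) ≡ matrix (u j)
    u≡ = tr-det-determined (matrix (u i)) (matrix (u j)) (det-1 (u i)) (det-1 (u j)) (trace-0 (u i)) (trace-0 (u j))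
      (proj₁ corners≡) (proj₂ corners≡)

-- Permutation groups: images of subsets, normality of the socle, conjugate stabilizers, elementary
-- abelian groups.

module _ {v : ℕ} where

  conj : Perm v → Perm v → Perm v
  conj g n = (g · n) · flip g

  ≈⇒≈ˡ : ∀ (g h : Perm v) → g ≈ h → ∀ y → g ⟨$⟩ˡ y ≡ h ⟨$⟩ˡ y
  ≈⇒≈ˡ g h g≈h y = begin
    g ⟨$⟩ˡ y                        ≡⟨ cong (g ⟨$⟩ˡ_) (inverseʳ h) ⟨
    g ⟨$⟩ˡ (h ⟨$⟩ʳ (h ⟨$⟩ˡ y))      ≡⟨ cong (g ⟨$⟩ˡ_) (g≈h (h ⟨$⟩ˡ y)) ⟨
    g ⟨$⟩ˡ (g ⟨$⟩ʳ (h ⟨$⟩ˡ y))      ≡⟨ inverseˡ g ⟩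
    h ⟨$⟩ˡ y                        ∎
    where open ≡-Reasoning

  ≡ʳ⇒≡ˡ : ∀ (g : Perm v) {x y} → g ⟨$⟩ʳ x ≡ y → g ⟨$⟩ˡ y ≡ x
  ≡ʳ⇒≡ˡ g refl = inverseˡ g

  []-cong : ∀ (g h : Perm v) S → g ≈ h → g [ S ] ≡ h [ S ]
  []-cong g h S g≈h = tabulate-cong (λ y → cong (lookup S) (≈⇒≈ˡ g h g≈h y))

  []-· : ∀ (g h : Perm v) S → (g · h) [ S ] ≡ g [ h [ S ] ]
  []-· g h S = tabulate-cong (λ y → sym (lookup∘tabulate (λ z → lookup S (h ⟨$⟩ˡ z)) (g ⟨$⟩ˡ y)))

  []-id : ∀ (S : Subset v) → id [ S ] ≡ S
  []-id S = tabulate∘lookup S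

  ∈-[] : ∀ (g : Perm v) S x → (g ⟨$⟩ˡ x) ∈ S → x ∈ g [ S ]
  ∈-[] g S x ∈S = lookup⇒[]= x (g [ S ]) (trans (lookup∘tabulate _ x) ([]=⇒lookup ∈S))

  []-∈ : ∀ (g : Perm v) S x → x ∈ g [ S ] → (g ⟨$⟩ˡ x) ∈ S
  []-∈ g S x x∈ = lookup⇒[]= (g ⟨$⟩ˡ x) S (trans (sym (lookup∘tabulate (λ y → lookup S (g ⟨$⟩ˡ y)) x)) ([]=⇒lookup x∈))

  socle⊑ : ∀ {G T : PermSet v} → IsSubgroup G → IsSocle G T → T ⊑ G
  socle⊑ {G} G-subgroup (_ , _ , least) = least G G-subgroup (λ N min → proj₁ (proj₂ (proj₁ min)))

  -- Minimal normal subgroups are invariant under conjugation, so g⁻¹ T g contains all of them.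
  socle-normal : ∀ {G T : PermSet v} → IsSocle G T → ∀ g n → G g → T n → T (conj g n)
  socle-normal {G} {T} (T-subgroup , contains , least) g n Gg Tn = least H H-subgroup N⊑H n Tn
    where
    open IsSubgroup T-subgroup
    H : PermSet v
    H n = T (conj g n)
    H-subgroup : IsSubgroup H
    H-subgroup = record
      { resp   = λ a b a≈b → resp (conj g a) (conj g b) (λ x → cong (g ⟨$⟩ʳ_) (a≈b (g ⟨$⟩ˡ x)))
      ; has-id = resp id (conj g id) (λ x → sym (inverseʳ g)) has-id
      ; mul    = λ a b Ha Hb → resp (conj g a · conj g b) (conj g (a · b))
                   (λ x → cong (λ z → g ⟨$⟩ʳ (a ⟨$⟩ʳ z)) (inverseˡ g)) (mul (conj g a) (conj g b) Ha Hb)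
      ; inv    = λ a Ha → resp (flip (conj g a)) (conj g (flip a)) (λ x → refl) (inv (conj g a) Ha)
      }
    N⊑H : ∀ N → IsMinimalNormal G N → N ⊑ H
    N⊑H N min m Nm = contains N min (conj g m) (proj₂ (proj₂ (proj₁ min)) g m Gg Nm)

  -- An element normalizing T conjugates the stabilizer of `x` onto that of its image. This spreads
  -- the dihedral hypothesis from one point to all.
  stabilizer-conjugate : ∀ {T : PermSet v} {C : Set} {_∙_ : C → C → C} → ∀ g →
    (∀ n → T n → T (conj g n)) → (∀ n → T n → T (conj (flip g) n)) →
    ∀ x y → g ⟨$⟩ʳ x ≡ y → IsoTo (PointStab T x) C _∙_ → IsoTo (PointStab T y) C _∙_
  stabilizer-conjugate g T-conj T-conj⁻¹ x y gx≡y (ψ , ψ-in , ψ-hom , ψ-inj , ψ-onto) =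
    (λ c → conj g (ψ c)) ,
    (λ c → T-conj (ψ c) (proj₁ (ψ-in c)) ,
      trans (cong (λ z → g ⟨$⟩ʳ (ψ c ⟨$⟩ʳ z)) (≡ʳ⇒≡ˡ g gx≡y)) (trans (cong (g ⟨$⟩ʳ_) (proj₂ (ψ-in c))) gx≡y)) ,
    (λ c d z → trans (cong (g ⟨$⟩ʳ_) (ψ-hom c d (g ⟨$⟩ˡ z)))
      (cong (λ w → g ⟨$⟩ʳ (ψ c ⟨$⟩ʳ w)) (sym (inverseˡ g)))) ,
    (λ c d eq → ψ-inj c d (λ z → begin
      ψ c ⟨$⟩ʳ z                                             ≡⟨ conj-at c z ⟨
      g ⟨$⟩ˡ (conj g (ψ c) ⟨$⟩ʳ (g ⟨$⟩ʳ z))                  ≡⟨ cong (g ⟨$⟩ˡ_) (eq (g ⟨$⟩ʳ z)) ⟩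
      g ⟨$⟩ˡ (conj g (ψ d) ⟨$⟩ʳ (g ⟨$⟩ʳ z))                  ≡⟨ conj-at d z ⟩
      ψ d ⟨$⟩ʳ z                                             ∎)) ,
    λ h (Th , hy≡y) →
      let c , ψc≈ = ψ-onto (conj (flip g) h) (T-conj⁻¹ h Th ,
            trans (cong (λ z → g ⟨$⟩ˡ (h ⟨$⟩ʳ z)) gx≡y) (trans (cong (g ⟨$⟩ˡ_) hy≡y) (≡ʳ⇒≡ˡ g gx≡y)))
      in c , λ z → trans (cong (g ⟨$⟩ʳ_) (ψc≈ (g ⟨$⟩ˡ z)))
                     (trans (inverseʳ g) (cong (h ⟨$⟩ʳ_) (inverseʳ g)))
    where
    open ≡-Reasoning
    conj-at : ∀ c z → g ⟨$⟩ˡ (conj g (ψ c) ⟨$⟩ʳ (g ⟨$⟩ʳ z)) ≡ ψ c ⟨$⟩ʳ z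
    conj-at c z = trans (inverseˡ g) (cong (ψ c ⟨$⟩ʳ_) (inverseˡ g))

  ElemAbMul-self : ∀ {n} (c : Vec Bool n) → ElemAbMul n c c ≡ replicate n false
  ElemAbMul-self []      = refl
  ElemAbMul-self (x ∷ c) = cong₂ _∷_ (xor-same x) (ElemAbMul-self c)

  -- The common content of the two alternatives for T_B.
  record ElementaryAbelian (H : PermSet v) : Set where
    field
      nontrivial : ∃ λ g → H g × ¬ (g ≈ id)
      commute    : ∀ g h → H g → H h → (g · h) ≈ (h · g)
      exponent-2 : ∀ g → H g → (g · g) ≈ id

  elementaryAbelian : ∀ {H : PermSet v} n → IsoTo H (Vec Bool (suc n)) (ElemAbMul (suc n)) → ElementaryAbelian H
  elementaryAbelian {H} n (ψ , ψ-in , ψ-hom , ψ-inj , ψ-onto) = record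
    { nontrivial = ψ e , ψ-in e , λ ψe≈id →
        contradiction (ψ-inj e o (λ x → trans (ψe≈id x) (sym (ψo≈id x)))) λ ()
    ; commute    = λ g h Hg Hh → commute g h (ψ-onto g Hg) (ψ-onto h Hh)
    ; exponent-2 = λ g Hg → exponent-2 g (ψ-onto g Hg)
    }
    where
    open ≡-Reasoning
    o e : Vec Bool (suc n)
    o = replicate (suc n) false
    e = true ∷ replicate n false
    ψo≈id : ψ o ≈ id
    ψo≈id x = begin
      ψ o ⟨$⟩ʳ x                              ≡⟨ inverseˡ (ψ o) ⟨
      ψ o ⟨$⟩ˡ (ψ o ⟨$⟩ʳ (ψ o ⟨$⟩ʳ x))        ≡⟨ cong (ψ o ⟨$⟩ˡ_) (ψ-hom o o x) ⟨
      ψ o ⟨$⟩ˡ (ψ (ElemAbMul _ o o) ⟨$⟩ʳ x)   ≡⟨ cong (λ c → ψ o ⟨$⟩ˡ (ψ c ⟨$⟩ʳ x)) (ElemAbMul-self o) ⟩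
      ψ o ⟨$⟩ˡ (ψ o ⟨$⟩ʳ x)                   ≡⟨ inverseˡ (ψ o) ⟩
      x                                       ∎
    product : ∀ g h c d → ψ c ≈ g → ψ d ≈ h → ∀ x → g ⟨$⟩ʳ (h ⟨$⟩ʳ x) ≡ ψ (ElemAbMul _ c d) ⟨$⟩ʳ x
    product g h c d ψc≈g ψd≈h x = trans (cong (g ⟨$⟩ʳ_) (sym (ψd≈h x)))
      (trans (sym (ψc≈g (ψ d ⟨$⟩ʳ x))) (sym (ψ-hom c d x)))
    commute : ∀ g h → (∃ λ c → ψ c ≈ g) → (∃ λ d → ψ d ≈ h) → (g · h) ≈ (h · g)
    commute g h (c , ψc≈g) (d , ψd≈h) x = trans (product g h c d ψc≈g ψd≈h x)
      (trans (cong (λ z → ψ z ⟨$⟩ʳ x) (zipWith-comm xor-comm c d)) (sym (product h g d c ψd≈h ψc≈g x)))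
    exponent-2 : ∀ g → (∃ λ c → ψ c ≈ g) → (g · g) ≈ id
    exponent-2 g (c , ψc≈g) x = trans (product g g c c ψc≈g ψc≈g x)
      (trans (cong (λ z → ψ z ⟨$⟩ʳ x) (ElemAbMul-self c)) (ψo≈id x))

open import Data.Nat using (_+_; _*_; _∸_; _^_; _<_)

-- The flag-transitive design and its contradiction.

module Contradiction
  {q′ : ℕ} (F : FieldOn (suc q′))
  (1+1≡0 : FieldOn._+_ F (FieldOn.1# F) (FieldOn.1# F) ≡ FieldOn.0# F)
  {v b k : ℕ} (k*2≡q : k * 2 ≡ suc q′) (v*2≡q[q-1] : v * 2 ≡ suc q′ * q′)
  (0<k : 0 < k) (qq<b : suc q′ * suc q′ < b)
  (D : Design v b k) (0<replication : ∀ x → 0 < replication D x)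
  (G T : PermSet v) (G-aut : IsAutGroup D G) (flag-transitive : FlagTransitive D G) (socle : IsSocle G T)
  (φ : SL2 F → Perm v) (φ-in : ∀ A → T (φ A))
  (φ-hom : ∀ A B C → proj₁ C ≡ matMul F (proj₁ A) (proj₁ B) → φ C ≈ φ A · φ B)
  (φ-kernel : ∀ A → φ A ≈ id → IsScalar F (proj₁ A))
  (φ-scalar : ∀ A → IsScalar F (proj₁ A) → φ A ≈ id)
  (φ-onto : ∀ g → T g → ∃ λ A → φ A ≈ g)
  (x₀ : Fin v) (dihedral : IsoTo (PointStab T x₀) _ (DihedralMul (suc q′)))
  (i₀ : Fin b) (E-abelian : ElementaryAbelian (SetStab T (block D i₀)))
  where
  open Characteristic2 F 1+1≡0 hiding (_+_; _*_)

  act : SL → Fin v → Fin v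
  act A x = φ A ⟨$⟩ʳ x

  act-1 : ∀ A → proj₁ A ≡ I → ∀ x → act A x ≡ x
  act-1 A A≡I = φ-scalar A (subst (IsScalar F) (sym A≡I) (refl , refl , refl))

  act-⊗ : ∀ A B C → proj₁ C ≡ proj₁ A ⊗ proj₁ B → ∀ x → act C x ≡ act A (act B x)
  act-⊗ A B C C≡AB x = φ-hom A B C C≡AB x

  -- The kernel of `φ` consists of scalars, and the only scalar of determinant 1 is I; so identities
  -- between permutations can be read as identities between matrices.
  faithful : ∀ A B → (∀ x → act A x ≡ act B x) → proj₁ A ≡ proj₁ B
  faithful A B A≈B = quotient≡I A B (scalar⇒I (proj₁ C) (proj₂ C) (φ-kernel C (λ x →
    trans (act-⊗ (B ⁻¹ₛ) A C refl x) (trans (cong (act (B ⁻¹ₛ)) (A≈B x))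
      (trans (sym (act-⊗ (B ⁻¹ₛ) B ((B ⁻¹ₛ) ⊙ B) refl x)) (act-1 ((B ⁻¹ₛ) ⊙ B) (adj-inverse (proj₁ B) (proj₂ B)) x))))))
    where
    C : SL
    C = (B ⁻¹ₛ) ⊙ A

  G-subgroup : IsSubgroup G
  G-subgroup = proj₁ G-aut

  T⊑G : T ⊑ G
  T⊑G = socle⊑ G-subgroup socle

  T-normal : ∀ g n → G g → T n → T (conj g n)
  T-normal = socle-normal socle

  block-through : ∀ x → ∃ λ i → x ∈ block D i
  block-through x = i , lookup⇒[]= x (block D i) (trans (sym (lookup∘tabulate (λ i → lookup (block D i) x) i)) ([]=⇒lookup (proj₂ point)))
    where
    point : ∃ λ i → i ∈ tabulate (λ i → lookup (block D i) x)
    point = ∣∣>0⇒nonempty (tabulate (λ i → lookup (block D i) x)) (0<replication x)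
    i = proj₁ point

  -- Every point lies on a block, so flag-transitivity makes G transitive on points, and G
  -- normalizes T. Transitivity of T cannot serve here, since it is derived from this statement.
  point-dihedral : ∀ x → IsoTo (PointStab T x) (Fin (suc (suc q′)) × Bool) (DihedralMul (suc q′))
  point-dihedral x = stabilizer-conjugate g (λ n → T-normal g n Gg)
    (λ n → T-normal (flip g) n (IsSubgroup.inv G-subgroup g Gg)) x₀ x gx₀≡x dihedral
    where
    mover : ∃ λ g → G g × g ⟨$⟩ʳ x₀ ≡ x × g [ block D (proj₁ (block-through x₀)) ] ≡ block D (proj₁ (block-through x))
    mover = flag-transitive x₀ (proj₁ (block-through x₀)) x (proj₁ (block-through x)) (proj₂ (block-through x₀)) (proj₂ (block-through x))
    g = proj₁ mover
    Gg : G g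
    Gg = proj₁ (proj₂ mover)
    gx₀≡x : g ⟨$⟩ʳ x₀ ≡ x
    gx₀≡x = proj₁ (proj₂ (proj₂ mover))

  stabilizer : ∀ x → Σ (Fin (suc (suc q′)) × Bool → SL) λ δ →
    (∀ c d → proj₁ (δ (DihedralMul (suc q′) c d)) ≡ proj₁ (δ c) ⊗ proj₁ (δ d)) ×
    (∀ c d → proj₁ (δ c) ≡ proj₁ (δ d) → c ≡ d) ×
    (∀ c → act (δ c) x ≡ x) ×
    (∀ A → act A x ≡ x → ∃ λ c → proj₁ (δ c) ≡ proj₁ A)
  stabilizer x = lift (point-dihedral x)
    where
    lift : IsoTo (PointStab T x) (Fin (suc (suc q′)) × Bool) (DihedralMul (suc q′)) → _
    lift (ψ , ψ-in , ψ-hom , ψ-inj , ψ-onto) = δ , δ-hom , δ-inj , δ-fixes , δ-onto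
      where
      δ : Fin (suc (suc q′)) × Bool → SL
      δ c = proj₁ (φ-onto (ψ c) (proj₁ (ψ-in c)))
      φδ : ∀ c y → act (δ c) y ≡ ψ c ⟨$⟩ʳ y
      φδ c = proj₂ (φ-onto (ψ c) (proj₁ (ψ-in c)))
      δ-hom : ∀ c d → proj₁ (δ (DihedralMul (suc q′) c d)) ≡ proj₁ (δ c) ⊗ proj₁ (δ d)
      δ-hom c d = faithful (δ (DihedralMul (suc q′) c d)) (δ c ⊙ δ d) (λ y → begin
        act (δ (DihedralMul (suc q′) c d)) y   ≡⟨ φδ (DihedralMul (suc q′) c d) y ⟩
        ψ (DihedralMul (suc q′) c d) ⟨$⟩ʳ y    ≡⟨ ψ-hom c d y ⟩
        ψ c ⟨$⟩ʳ (ψ d ⟨$⟩ʳ y)                  ≡⟨ φδ c (ψ d ⟨$⟩ʳ y) ⟨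
        act (δ c) (ψ d ⟨$⟩ʳ y)                 ≡⟨ cong (act (δ c)) (φδ d y) ⟨
        act (δ c) (act (δ d) y)                ≡⟨ act-⊗ (δ c) (δ d) (δ c ⊙ δ d) refl y ⟨
        act (δ c ⊙ δ d) y                      ∎)
        where open ≡-Reasoning
      δ-inj : ∀ c d → proj₁ (δ c) ≡ proj₁ (δ d) → c ≡ d
      δ-inj c d δc≡δd = ψ-inj c d (λ y → trans (sym (φδ c y)) (trans
        (trans (act-⊗ (δ d) 1ₛ (δ c) (trans δc≡δd (sym (⊗-identityʳ (proj₁ (δ d))))) y) (cong (act (δ d)) (act-1 1ₛ refl y)))
        (φδ d y)))
      δ-fixes : ∀ c → act (δ c) x ≡ x
      δ-fixes c = trans (φδ c x) (proj₂ (ψ-in c))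
      δ-onto : ∀ A → act A x ≡ x → ∃ λ c → proj₁ (δ c) ≡ proj₁ A
      δ-onto A Ax≡x = c , faithful (δ c) A (λ y → trans (φδ c y) (proj₂ (ψ-onto (φ A) (φ-in A , Ax≡x)) y))
        where
        c = proj₁ (ψ-onto (φ A) (φ-in A , Ax≡x))

  open DihedralAction F 1+1≡0 {k} {v} k*2≡q v*2≡q[q-1] act act-1 act-⊗ stabilizer
  open Involution
  open ElementaryAbelian E-abelian

  B : Subset v
  B = block D i₀

  lift-involution : ∀ g → T g → (g · g) ≈ id → ¬ (g ≈ id) → ∃ λ u → ∀ x → act (element u) x ≡ g ⟨$⟩ʳ x
  lift-involution g Tg gg≈id g≉id = involution A
    (involution⇒tr≡0 (proj₁ A) (faithful (A ⊙ A) 1ₛ λ x → begin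
      act (A ⊙ A) x            ≡⟨ act-⊗ A A (A ⊙ A) refl x ⟩
      act A (act A x)          ≡⟨ A≈g (act A x) ⟩
      g ⟨$⟩ʳ (act A x)         ≡⟨ cong (g ⟨$⟩ʳ_) (A≈g x) ⟩
      g ⟨$⟩ʳ (g ⟨$⟩ʳ x)        ≡⟨ gg≈id x ⟩
      x                        ≡⟨ act-1 1ₛ refl x ⟨
      act 1ₛ x                 ∎))
    (λ A≡I → g≉id (λ x → trans (sym (A≈g x)) (act-1 A A≡I x))) , A≈g
    where
    open ≡-Reasoning
    A : SL
    A = proj₁ (φ-onto g Tg)
    A≈g : ∀ x → act A x ≡ g ⟨$⟩ʳ x
    A≈g = proj₂ (φ-onto g Tg)

  u₀-lift : ∃ λ u → ∀ x → act (element u) x ≡ proj₁ nontrivial ⟨$⟩ʳ x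
  u₀-lift = lift-involution (proj₁ nontrivial) (proj₁ (proj₁ (proj₂ nontrivial)))
    (exponent-2 (proj₁ nontrivial) (proj₁ (proj₂ nontrivial))) (proj₂ (proj₂ nontrivial))

  u₀ : Involution
  u₀ = proj₁ u₀-lift

  block-stabilizer-commutes : ∀ X → φ X [ B ] ≡ B → proj₁ X ⊗ matrix u₀ ≡ matrix u₀ ⊗ proj₁ X
  block-stabilizer-commutes X XB≡B = faithful (X ⊙ element u₀) (element u₀ ⊙ X) (λ x → begin
    act (X ⊙ element u₀) x          ≡⟨ act-⊙ X (element u₀) x ⟩
    act X (act (element u₀) x)      ≡⟨ cong (act X) (u₀≈ x) ⟩
    act X (e ⟨$⟩ʳ x)                ≡⟨ commute (φ X) e (φ-in X , XB≡B) (proj₁ (proj₂ nontrivial)) x ⟩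
    e ⟨$⟩ʳ (act X x)                ≡⟨ u₀≈ (act X x) ⟨
    act (element u₀) (act X x)      ≡⟨ act-⊙ (element u₀) X x ⟨
    act (element u₀ ⊙ X) x          ∎)
    where
    open ≡-Reasoning
    e = proj₁ nontrivial
    u₀≈ = proj₂ u₀-lift

  point : ∃ λ x → x ∈ B
  point = ∣∣>0⇒nonempty B (subst (0 <_) (sym (block-size D i₀)) 0<k)

  x : Fin v
  x = proj₁ point

  fixer : ∃ λ t → t ≢ 0# × act (pencilₛ u₀ t) x ≡ x
  fixer = pencil-fixer u₀ x

  -- The chosen element `u₀` of T_B may move `x`; `u` is the involution in the centralizer of `u₀`
  -- that fixes `x`, and is the candidate for fixing all of B.
  u : Involution
  u = pencil-involution u₀ (proj₁ fixer) (proj₁ (proj₂ fixer))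

  translate : ∀ X → ∃ λ j → φ X [ B ] ≡ block D j
  translate X = proj₂ G-aut (φ X) (T⊑G (φ X) (φ-in X)) i₀

  -- B, τ B and h B all contain x and y, so two of them coincide; hence τ, h or τ h stabilizes B.
  B-fixed : ∀ y → y ∈ B → act (element u) y ≡ y
  B-fixed y y∈B = by-equality (x ≟ y)
    where
    t = proj₁ fixer
    t≢0 = proj₁ (proj₂ fixer)
    tx≡x = proj₂ (proj₂ fixer)
    pair = pair-stabilizer x y
    τ = proj₁ pair
    h = proj₁ (proj₂ pair)
    τx≡x : act (element τ) x ≡ x
    τx≡x = proj₁ (proj₂ (proj₂ pair))
    τy≡y : act (element τ) y ≡ y
    τy≡y = proj₁ (proj₂ (proj₂ (proj₂ pair)))
    hx≡y : act h x ≡ y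
    hx≡y = proj₁ (proj₂ (proj₂ (proj₂ (proj₂ pair))))
    hy≡x : act h y ≡ x
    hy≡x = proj₂ (proj₂ (proj₂ (proj₂ (proj₂ pair))))
    j₁ j₂ : Fin b
    j₁ = proj₁ (translate (element τ))
    j₂ = proj₁ (translate h)
    τB≡ : φ (element τ) [ B ] ≡ block D j₁
    τB≡ = proj₂ (translate (element τ))
    hB≡ : φ h [ B ] ≡ block D j₂
    hB≡ = proj₂ (translate h)
    in-translate : ∀ X j → φ X [ B ] ≡ block D j → ∀ {z w} → act X z ≡ w → z ∈ B → w ∈ block D j
    in-translate X j XB≡ {z} {w} Xz≡w z∈B = subst (w ∈_) XB≡ (∈-[] (φ X) B w (subst (_∈ B) (sym (≡ʳ⇒≡ˡ (φ X) Xz≡w)) z∈B))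
    blocks-on-xy : Subset b
    blocks-on-xy = tabulate (λ i → lookup (block D i) x ∧ lookup (block D i) y)
    on-xy : ∀ i → x ∈ block D i → y ∈ block D i → i ∈ blocks-on-xy
    on-xy i x∈ y∈ = lookup⇒[]= i blocks-on-xy (trans (lookup∘tabulate (λ i → lookup (block D i) x ∧ lookup (block D i) y) i)
      (cong₂ _∧_ ([]=⇒lookup x∈) ([]=⇒lookup y∈)))
    i₀∈ : i₀ ∈ blocks-on-xy
    i₀∈ = on-xy i₀ (proj₂ point) y∈B
    j₁∈ : j₁ ∈ blocks-on-xy
    j₁∈ = on-xy j₁ (in-translate (element τ) j₁ τB≡ τx≡x (proj₂ point)) (in-translate (element τ) j₁ τB≡ τy≡y y∈B)
    -- As `h` interchanges the two points, `x` lies in h B because `y` lies in B, and conversely.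
    j₂∈ : j₂ ∈ blocks-on-xy
    j₂∈ = on-xy j₂ (in-translate h j₂ hB≡ hy≡x y∈B) (in-translate h j₂ hB≡ hx≡y (proj₂ point))
    -- An element of T_B commutes with `u₀`, hence with `u`, so it carries the fixed point `x` of
    -- `u` to another fixed point of `u`.
    via-mover : ∀ X → act X x ≡ y → φ X [ B ] ≡ B → act (element u) y ≡ y
    via-mover X Xx≡y XB≡B = subst (λ z → act (element u) z ≡ z) Xx≡y
      (pencil-fixes-image u₀ X t x (block-stabilizer-commutes X XB≡B) tx≡x)
    τh : SL
    τh = element τ ⊙ h
    τhx≡y : act τh x ≡ y
    τhx≡y = trans (act-⊙ (element τ) h x) (trans (cong (act (element τ)) hx≡y) τy≡y)
    ττ≈id : (φ (element τ) · φ (element τ)) ≈ id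
    ττ≈id z = trans (sym (act-⊙ (element τ) (element τ) z)) (act-1 (element τ ⊙ element τ) (square τ) z)
    τhB≡B : j₁ ≡ j₂ → φ τh [ B ] ≡ B
    τhB≡B j₁≡j₂ = begin
      φ τh [ B ]                                 ≡⟨ []-cong (φ τh) (φ (element τ) · φ h) B (φ-hom (element τ) h τh refl) ⟩
      (φ (element τ) · φ h) [ B ]                ≡⟨ []-· (φ (element τ)) (φ h) B ⟩
      φ (element τ) [ φ h [ B ] ]                ≡⟨ cong (φ (element τ) [_]) (trans hB≡ (trans (cong (block D) (sym j₁≡j₂)) (sym τB≡))) ⟩
      φ (element τ) [ φ (element τ) [ B ] ]      ≡⟨ []-· (φ (element τ)) (φ (element τ)) B ⟨
      (φ (element τ) · φ (element τ)) [ B ]      ≡⟨ []-cong (φ (element τ) · φ (element τ)) id B ττ≈id ⟩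
      id [ B ]                                   ≡⟨ []-id B ⟩
      B                                          ∎
      where open ≡-Reasoning
    by-blocks : x ≢ y → Dec (i₀ ≡ j₁) → Dec (i₀ ≡ j₂) → Dec (j₁ ≡ j₂) → act (element u) y ≡ y
    -- Here `τ` lies in T_B, so it commutes with `u₀`; fixing `x`, it must be `u`.
    by-blocks _ (yes i₀≡j₁) _ _ = pencil-fixes-common u₀ τ t x y t≢0
      (block-stabilizer-commutes (element τ) (trans τB≡ (cong (block D) (sym i₀≡j₁)))) τx≡x τy≡y tx≡x
    by-blocks _ (no _) (yes i₀≡j₂) _ = via-mover h hx≡y (trans hB≡ (cong (block D) (sym i₀≡j₂)))
    by-blocks _ (no _) (no _) (yes j₁≡j₂) = via-mover τh τhx≡y (τhB≡B j₁≡j₂)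
    by-blocks x≢y (no i₀≢j₁) (no i₀≢j₂) (no j₁≢j₂) = contradiction
      (subst (2 <_) (pair-count D x y x≢y) (distinct-triple i₀∈ j₁∈ j₂∈ i₀≢j₁ i₀≢j₂ j₁≢j₂)) (ℕ.<-irrefl refl)
    by-equality : Dec (x ≡ y) → act (element u) y ≡ y
    by-equality (yes x≡y) = subst (λ z → act (element u) z ≡ z) x≡y tx≡x
    by-equality (no x≢y)  = by-blocks x≢y (i₀ ≟ j₁) (i₀ ≟ j₂) (j₁ ≟ j₂)

  -- Some g in G carries B to the given block, and conjugates `u` to an involution fixing that block
  -- pointwise. Normality of T in G keeps the conjugate in T, so it comes from a matrix.
  every-block-fixed : ∀ j → ∃ λ w → ∀ y → y ∈ block D j → act (element w) y ≡ y
  every-block-fixed j = proj₁ w-lift , λ y y∈ → trans (proj₂ w-lift y)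
    (trans (cong (g ⟨$⟩ʳ_) (B-fixed (g ⟨$⟩ˡ y) ([]-∈ g B y (subst (y ∈_) (sym gB≡) y∈)))) (inverseʳ g))
    where
    open ≡-Reasoning
    target : ∃ λ z → z ∈ block D j
    target = ∣∣>0⇒nonempty (block D j) (subst (0 <_) (sym (block-size D j)) 0<k)
    mover : ∃ λ g → G g × g ⟨$⟩ʳ x ≡ proj₁ target × g [ B ] ≡ block D j
    mover = flag-transitive x i₀ (proj₁ target) j (proj₂ point) (proj₂ target)
    g = proj₁ mover
    gB≡ : g [ B ] ≡ block D j
    gB≡ = proj₂ (proj₂ (proj₂ mover))
    n : Perm v
    n = φ (element u)
    nn≈id : ∀ z → n ⟨$⟩ʳ (n ⟨$⟩ʳ z) ≡ z
    nn≈id z = trans (sym (act-⊙ (element u) (element u) z)) (act-1 (element u ⊙ element u) (square u) z)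
    w-lift : ∃ λ w → ∀ y → act (element w) y ≡ conj g n ⟨$⟩ʳ y
    w-lift = lift-involution (conj g n) (T-normal g n (proj₁ (proj₂ mover)) (φ-in (element u)))
      (λ z → trans (cong (λ y → g ⟨$⟩ʳ (n ⟨$⟩ʳ y)) (inverseˡ g)) (trans (cong (g ⟨$⟩ʳ_) (nn≈id (g ⟨$⟩ˡ z))) (inverseʳ g)))
      (λ conj≈id → ≢I u (faithful (element u) 1ₛ (λ z → begin
        n ⟨$⟩ʳ z                                  ≡⟨ cong (n ⟨$⟩ʳ_) (inverseˡ g) ⟨
        n ⟨$⟩ʳ (g ⟨$⟩ˡ (g ⟨$⟩ʳ z))                ≡⟨ inverseˡ g ⟨
        g ⟨$⟩ˡ (conj g n ⟨$⟩ʳ (g ⟨$⟩ʳ z))         ≡⟨ cong (g ⟨$⟩ˡ_) (conj≈id (g ⟨$⟩ʳ z)) ⟩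
        g ⟨$⟩ˡ (g ⟨$⟩ʳ z)                         ≡⟨ inverseˡ g ⟩
        z                                         ≡⟨ act-1 1ₛ refl z ⟨
        act 1ₛ z                                  ∎)))

  impossible : ⊥
  impossible = too-many-blocks (block D) (block-injective D) (block-size D) 0<k qq<b every-block-fixed

-- Applied to n = q², this says that there are more blocks than pairs of off-diagonal entries.
n<2[n∸1] : ∀ n → 2 < n → n < 2 * (n ∸ 1)
n<2[n∸1] (suc zero)          (ℕ.s≤s ())
n<2[n∸1] (suc (suc zero))    (ℕ.s≤s (ℕ.s≤s ()))
n<2[n∸1] (suc (suc (suc n))) _ = ℕ.s≤s (ℕ.s≤s (ℕ.≤-trans (ℕ.≤-reflexive (sym (ℕ.+-comm n 2)))
  (ℕ.+-monoʳ-≤ n (ℕ.s≤s (ℕ.s≤s ℕ.z≤n)))))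

theorem2p2 : (f q : ℕ) → q ≡ 2 ^ f → 8 < q →
    (v b r k : ℕ) → v * 2 ≡ q * (q ∸ 1) → b ≡ 2 * (q * q ∸ 1) →
    r ≡ 2 * (q + 1) → k * 2 ≡ q → 2 < k → k < v ∸ 1 →
    (D : Design v b k) → (∀ x → replication D x ≡ r) →
    ¬ (Σ (PermSet v) λ G → Σ (PermSet v) λ T →
    IsAutGroup D G × FlagTransitive D G × IsSocle G T × IsoPSL2 q T ×
    (∃ λ x → IsoTo (PointStab T x) _ (DihedralMul q)) ×
    (∃ λ i → IsoTo (SetStab T (block D i)) _ (ElemAbMul (f ∸ 1))
    ⊎ IsoTo (SetStab T (block D i)) _ (ElemAbMul f)))
-- The cases f = 0 and f = 1 contradict q > 8. From f = 2 on, the exponent f - 1 is positive, so T_B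
-- is nontrivial in either alternative.
theorem2p2 zero          _        refl (ℕ.s≤s ())
theorem2p2 (suc zero)    _        refl (ℕ.s≤s (ℕ.s≤s ()))
theorem2p2 (suc (suc f)) (suc q′) q≡2^f 8<q v b r k v*2≡ refl refl k*2≡q 2<k _ D replication≡r
  (G , T , aut , flag , socle , (F , φ , φ-in , φ-hom , φ-kernel , φ-scalar , φ-onto) , (x₀ , dihedral) , i₀ , E) =
  Contradiction.impossible F (FieldProperties.characteristic-2 F (suc (suc f)) q≡2^f) k*2≡q v*2≡ 0<k
    (n<2[n∸1] (suc q′ * suc q′) (ℕ.<-≤-trans (ℕ.<-trans (ℕ.s≤s (ℕ.s≤s (ℕ.s≤s ℕ.z≤n))) 8<q) (ℕ.m≤m*n (suc q′) (suc q′))))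
    D (λ x → subst (0 <_) (sym (replication≡r x)) (ℕ.s≤s ℕ.z≤n))
    G T aut flag socle φ φ-in φ-hom φ-kernel φ-scalar φ-onto x₀ dihedral i₀ (abelian E)
  where
  0<k : 0 < k
  0<k = ℕ.<-trans (ℕ.s≤s ℕ.z≤n) 2<k
  abelian : ∀ {H : PermSet v} → IsoTo H _ (ElemAbMul (suc f)) ⊎ IsoTo H _ (ElemAbMul (suc (suc f))) → ElementaryAbelian H
  abelian (inj₁ iso) = elementaryAbelian f iso
  abelian (inj₂ iso) = elementaryAbelian (suc f) iso
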